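{- Let $\mathcal{G}$ be a connected simple undirected graph with vertex set $V$, let $\mathcal{T}$ be any dissecting tree set for $\mathcal{G}$, and let $v\in V$ be any vertex. Write the $h^*$-polynomial of the symmetric edge polytope $P_{\mathcal{G}}$ as $\sum_i (h^*_{\mathcal{G}})_i x^i$. Then for every $i$, $$(h^*_{\mathcal{G}})_i = |\{T\in \mathcal{T}\mid T \text{ has exactly } i \text{ edges pointing away from } v\}|.$$
   Context: For a vertex $u$, $\mathbf{1}_u$ denotes the corresponding standard basis vector of $\mathbb{R}^V$. The symmetric edge polytope is $P_{\mathcal{G}}=\mathrm{conv}\{\mathbf{1}_u-\mathbf{1}_w,\ \mathbf{1}_w-\mathbf{1}_u \mid uw\in E(\mathcal{G})\}\subset\mathbb{R}^V$. For a directed graph $D$, let $\mathcal{Q}_D=\mathrm{conv}\{\mathbf{1}_h-\mathbf{1}_t \mid \overrightarrow{th}\in E(D)\}$. An oriented spanning tree of $\mathcal{G}$ is a spanning tree of $\mathcal{G}$ in which each edge is given one of its two orientations. A dissecting tree set for $\mathcal{G}$ is a set $\mathcal{T}$ of oriented spanning trees of $\mathcal{G}$ such that the simplices $\mathcal{Q}_T$, $T\in\mathcal{T}$, dissect the boundary of $P_{\mathcal{G}}$, i.e. they have pairwise disjoint relative interiors and their union is the boundary of $P_{\mathcal{G}}$. For a directed tree $T$ and a vertex $v$, an edge $e\in T$ points away from $v$ in $T$ if $v$ lies in the component of $T-e$ containing the tail of $e$. For a $d$-dimensional lattice polytope $P\subset\mathbb{R}^n$ with Ehrhart polynomial $\varepsilon_P(t)=|tP\cap\mathbb{Z}^n|$,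 writing uniquely $\varepsilon_P(t)=\sum_{k=0}^d a_k\binom{t+d-k}{d}$, the $h^*$-polynomial of $P$ is $\sum_{k=0}^d a_k x^k$ (coefficients $a_k=0$ for $k>d$).
   Formalization: The polytopes, their relative interiors and boundary, the dissection condition and the dimension are taken over rational points (in ℚ^V) instead of real points (in ℝ^V). -}

module Defs where

open import Level using (Level)
open import Data.Nat.ListAction using (sum)

open import Data.Nat as ℕ using (ℕ; zero; suc; _∸_)
open import Data.Nat.Combinatorics using (_C_)
open import Data.Integer as ℤ using (ℤ)
open import Data.Rational as ℚ using (ℚ; 0ℚ; 1ℚ; _/_)
open import Data.Fin as Fin using (Fin; zero; suc)
open import Data.Bool using (Bool; true; false; if_then_else_)
open import Data.Vec as Vec using (Vec)
open import Data.List as List using (List; length; lookup; removeAt; filter; allFin; upTo; map; concatMap)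
open import Data.List.Membership.Propositional using (_∈_)
open import Data.List.Relation.Unary.Unique.Propositional using (Unique)
open import Data.Product using (Σ; ∃; _×_; _,_; proj₁; proj₂)
open import Data.Sum using (_⊎_)
open import Relation.Nullary using (¬_; does)
open import Relation.Binary.PropositionalEquality using (_≡_; _≢_)
open import Relation.Binary.Construct.Closure.ReflexiveTransitive using (Star)
open import Function.Bundles using (_⇔_)

HasCount : {ℓ : Level} {A : Set} → (A → Set ℓ) → ℕ → Set ℓ
HasCount {A = A} P k =
  Σ (List A) λ L → Unique L × (∀ x → (x ∈ L) ⇔ P x) × (length L ≡ k)

record SimpleGraph (n : ℕ) : Set where
  field
    adj   : Fin n → Fin n → Bool
    sym   : ∀ u w → adj u w ≡ adj w u
    irrefl : ∀ u → adj u u ≡ false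
open SimpleGraph public

Adj : ∀ {n} → SimpleGraph n → Fin n → Fin n → Set
Adj G u w = adj G u w ≡ true

Connected : ∀ {n} → SimpleGraph n → Set
Connected {n} G = ∀ (a b : Fin n) → Star (Adj G) a b

Pt : ℕ → Set
Pt n = Vec ℚ n

Σℚ : (m : ℕ) → (Fin m → ℚ) → ℚ
Σℚ zero    f = 0ℚ
Σℚ (suc m) f = f zero ℚ.+ Σℚ m (λ i → f (suc i))

lincomb : ∀ {n} (m : ℕ) → (Fin m → ℚ) → (Fin m → Pt n) → Pt n
lincomb {n} m c p = Vec.tabulate λ i → Σℚ m (λ j → c j ℚ.* Vec.lookup (p j) i)

_-ᵥ_ : ∀ {n} → Pt n → Pt n → Pt n
x -ᵥ y = Vec.zipWith ℚ._-_ x y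

0ᵥ : ∀ {n} → Pt n
0ᵥ = Vec.replicate _ 0ℚ

𝟏 : ∀ {n} → Fin n → Pt n
𝟏 u = Vec.tabulate λ i → if does (i Fin.≟ u) then 1ℚ else 0ℚ

InConv : ∀ {n} → List (Pt n) → Pt n → Set
InConv L x =
  Σ (Fin (length L) → ℚ) λ c →
    (∀ j → 0ℚ ℚ.≤ c j) × (Σℚ (length L) c ≡ 1ℚ) ×
    (x ≡ lincomb (length L) c (lookup L))

InRelInt : ∀ {n} → List (Pt n) → Pt n → Set
InRelInt L x =
  Σ (Fin (length L) → ℚ) λ c →
    (∀ j → 0ℚ ℚ.< c j) × (Σℚ (length L) c ≡ 1ℚ) ×
    (x ≡ lincomb (length L) c (lookup L))

InRelBoundary : ∀ {n} → List (Pt n) → Pt n → Set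
InRelBoundary L x = InConv L x × ¬ InRelInt L x

AffIndep : ∀ {n} (m : ℕ) → (Fin (suc m) → Pt n) → Set
AffIndep m p =
  ∀ (c : Fin m → ℚ) →
    lincomb m c (λ i → p (suc i) -ᵥ p zero) ≡ 0ᵥ → ∀ i → c i ≡ 0ℚ

IsDim : ∀ {n} → (Pt n → Set) → ℕ → Set
IsDim {n} P d =
  (Σ (Fin (suc d) → Pt n) λ p → (∀ i → P (p i)) × AffIndep d p) ×
  (∀ (p : Fin (suc (suc d)) → Pt n) → (∀ i → P (p i)) → ¬ AffIndep (suc d) p)

ℕ→ℚ : ℕ → ℚ
ℕ→ℚ t = ℤ.+ t / 1

ℤ→ℚ : ℤ → ℚ
ℤ→ℚ z = z / 1

InDilateLattice : ∀ {n} → (Pt n → Set) → ℕ → Vec ℤ n → Set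
InDilateLattice {n} P t z =
  Σ (Pt n) λ x → P x × (Vec.map (ℕ→ℚ t ℚ.*_) x ≡ Vec.map ℤ→ℚ z)

ehrhartSum : (ℕ → ℕ) → ℕ → ℕ → ℕ
ehrhartSum a d t = sum (map (λ k → a k ℕ.* ((t ℕ.+ (d ∸ k)) C d)) (upTo (suc d)))

IsHStar : ∀ {n} → (Pt n → Set) → (ℕ → ℕ) → Set
IsHStar P a =
  Σ ℕ λ d → IsDim P d × (∀ k → d ℕ.< k → a k ≡ 0) ×
    (∀ t → HasCount (InDilateLattice P t) (ehrhartSum a d t))

allPairs : (n : ℕ) → List (Fin n × Fin n)
allPairs n = concatMap (λ u → map (λ w → (u , w)) (allFin n)) (allFin n)

sepGenerators : ∀ {n} → SimpleGraph n → List (Pt n)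
sepGenerators {n} G =
  map (λ e → 𝟏 (proj₂ e) -ᵥ 𝟏 (proj₁ e))
      (filter (λ e → adj G (proj₁ e) (proj₂ e) Data.Bool.≟ true) (allPairs n))

InSEP : ∀ {n} → SimpleGraph n → Pt n → Set
InSEP G = InConv (sepGenerators G)

-- Oriented spanning trees: lists of arcs (tail , head)

Arc : ℕ → Set
Arc n = Fin n × Fin n

Und : ∀ {n} → List (Arc n) → Fin n → Fin n → Set
Und T a b = ((a , b) ∈ T) ⊎ ((b , a) ∈ T)

IsOrientedSpanningTree : ∀ {n} → SimpleGraph n → List (Arc n) → Set
IsOrientedSpanningTree {n} G T =
  (∀ e → e ∈ T → Adj G (proj₁ e) (proj₂ e)) ×
  (∀ (a b : Fin n) → Star (Und T) a b) ×
  (length T ≡ n ∸ 1)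

QVerts : ∀ {n} → List (Arc n) → List (Pt n)
QVerts = map (λ e → 𝟏 (proj₂ e) -ᵥ 𝟏 (proj₁ e))

PointsAway : ∀ {n} → (T : List (Arc n)) → Fin n → Fin (length T) → Set
PointsAway T v j = Star (Und (removeAt T j)) v (proj₁ (lookup T j))

IsDissectingTreeSet : ∀ {n} → SimpleGraph n → List (List (Arc n)) → Set
IsDissectingTreeSet {n} G 𝒯 =
  (∀ a → IsOrientedSpanningTree G (lookup 𝒯 a)) ×
  (∀ a b → a ≢ b → ∀ x →
     ¬ (InRelInt (QVerts (lookup 𝒯 a)) x × InRelInt (QVerts (lookup 𝒯 b)) x)) ×
  (∀ x → InRelBoundary (sepGenerators G) x ⇔
         (Σ (Fin (length 𝒯)) λ a → InConv (QVerts (lookup 𝒯 a)) x))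

AwayCount : ∀ {n} → List (List (Arc n)) → Fin n → ℕ → ℕ → Set
AwayCount 𝒯 v i c =
  HasCount (λ (a : Fin (length 𝒯)) → HasCount (PointsAway (lookup 𝒯 a) v) i) c

{-# OPTIONS --safe #-}

-- Fix the generic direction q = n·𝟏_v − Σ_u 𝟏_u. Its coordinate on an edge e of an oriented spanning
-- tree T is negative exactly when e points away from v. Every lattice point z of the hyperplane
-- Σ x_u = 0, pushed infinitesimally along q, lies in the interior of exactly one cone over the
-- simplices of the dissection; so the hyperplane is partitioned into half-open cones
-- { Σ x_e e : x_e ≥ 0, and x_e ≥ 1 if e points away from v }. The arcs of T form a lattice basis, and
-- since Q_T lies in the boundary of P_G, such a point lies in t·P_G iff Σ x_e ≤ t. With k edges
-- pointing away this gives C(t + d − k, d) points, and summing over T is the h*-expansion.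
--
-- The cone containing a given y is found by linear programming: a cheapest representation of y by
-- arcs of G exists by Fourier–Motzkin elimination, and scaled to cost 1 it lies on the boundary of P_G,
-- because relative interior points can be represented more cheaply (the arcs of G sum to zero).

module Submission where

open import Defs hiding (sym)
open import Level using (Level)
open import Data.Nat as ℕ using (ℕ; zero; suc; _≤_; z≤n; s≤s)
import Data.Nat.Properties as ℕP
open import Data.Nat.Combinatorics using (_C_; nCk+nC[k+1]≡[n+1]C[k+1]; k>n⇒nCk≡0)
open import Data.Nat.ListAction using (sum)
open import Data.Integer as ℤ using (ℤ; -[1+_])
import Data.Integer.Properties as ℤP
open import Data.Rational as ℚ using (ℚ; 0ℚ; 1ℚ; ½; _+_; _*_; -_; _-_)
import Data.Rational.Properties as ℚP
import Data.Rational.Unnormalised as ℚᵘ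
import Data.Rational.Unnormalised.Properties as ℚᵘP
open import Data.Rational.Solver using (module +-*-Solver)
open +-*-Solver using (solve; _:+_; _:*_; :-_; _:-_; _:=_; con)
open import Data.Fin as Fin using (Fin; zero; suc; punchIn)
open import Data.Fin.Properties using (nonZeroIndex; cast-is-id; cast-involutive; any?)
open import Data.Bool as Bool using (Bool; true; false; if_then_else_; not)
open import Data.Vec as Vec using (Vec; []; _∷_)
import Data.Vec.Properties as VecP
open import Data.Vec.Functional using (insertAt)
open import Data.Vec.Functional.Properties using (insertAt-lookup; insertAt-punchIn)
open import Data.List as List using (List; []; _∷_; _++_; length; lookup; map; filter; concatMap; cartesianProductWith; tabulate; removeAt; allFin; upTo; applyUpTo)
open import Data.List.Properties using (length-map; length-++; length-removeAt; map-upTo)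
open import Data.List.Membership.Propositional using (_∈_)
open import Data.List.Membership.Propositional.Properties using (∈-map⁺; ∈-map⁻; ∈-filter⁺; ∈-filter⁻; ∈-++⁺ˡ; ∈-++⁺ʳ; ∈-++⁻; ∈-tabulate⁺; ∈-tabulate⁻; ∈-lookup; ∈-concatMap⁺; ∈-allFin; ∈-cartesianProductWith⁺; ∈-cartesianProductWith⁻)
open import Data.List.Membership.Propositional.Properties.WithK using (unique∧set⇒bag)
open import Data.List.Relation.Binary.BagAndSetEquality using (∼bag⇒↭)
open import Data.List.Relation.Binary.Permutation.Propositional.Properties using (↭-length)
open import Data.List.Relation.Unary.Any as Any using (here; there)
open import Data.List.Relation.Unary.Any.Properties using (lookup-index)
open import Data.List.Relation.Unary.All using ([])
open import Data.List.Relation.Unary.AllPairs using ([]; _∷_)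
import Data.List.Relation.Unary.Unique.Propositional.Properties as Unique
open import Data.Product using (Σ; ∃; _×_; _,_; proj₁; proj₂)
open import Data.Sum using (_⊎_; inj₁; inj₂; [_,_]′)
open import Data.Empty using (⊥; ⊥-elim)
open import Relation.Nullary using (¬_; Dec; yes; no; does; ¬?)
open import Relation.Nullary.Decidable using (dec-true; dec-false; decidable-stable)
open import Relation.Unary using (Pred; Decidable)
open import Relation.Binary.Construct.Closure.ReflexiveTransitive as Star using (Star; ε; _◅_; _◅◅_)
open import Relation.Binary.Definitions using (Tri; tri<; tri≈; tri>)
open import Relation.Binary.PropositionalEquality
open import Function using (_∘_; id; case_of_)
open import Function.Bundles using (mk⇔; Equivalence)
open import Algebra.Properties.CommutativeSemigroup ℕP.+-commutativeSemigroup using (interchange)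
open Equivalence using (to; from)

-- The dissection hypothesis speaks only of the boundary of the polytope, and `InRelBoundary` is a
-- negative condition: membership without a strictly positive representation. To use it for an
-- arbitrary vector y of the hyperplane, some multiple of y must be known to lie on the boundary.
-- Constructively over ℚ no compactness argument yields that multiple; the least cost has to be
-- attained at an exact rational value, which is what elimination provides. This least cost is the
-- gauge of the polytope: below 1 in the relative interior, equal to 1 on the boundary. It serves a
-- second time for uniqueness, since representations over two trees share a boundary point only
-- after scaling by the same factor, and the gauge forces their costs to agree. The direction q
-- suits all trees at once: on an edge whose head component has S vertices its coordinate is n - S
-- or -S, according to whether v belongs to that component, and 0 < S < n.

≤-by : ∀ {x y} d → 0ℚ ℚ.≤ d → x + d ≡ y → x ℚ.≤ y
≤-by {x} d 0≤d refl = subst (ℚ._≤ x + d) (ℚP.+-identityʳ x) (ℚP.+-monoʳ-≤ x 0≤d)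

<-by : ∀ {x y} d → 0ℚ ℚ.< d → x + d ≡ y → x ℚ.< y
<-by {x} d 0<d refl = subst (ℚ._< x + d) (ℚP.+-identityʳ x) (ℚP.+-monoʳ-< x 0<d)

≤⇒0≤- : ∀ {x y} → x ℚ.≤ y → 0ℚ ℚ.≤ y - x
≤⇒0≤- {x} {y} x≤y = subst (ℚ._≤ y - x) (ℚP.+-inverseʳ x) (ℚP.+-monoˡ-≤ (- x) x≤y)

<⇒0<- : ∀ {x y} → x ℚ.< y → 0ℚ ℚ.< y - x
<⇒0<- {x} {y} x<y = subst (ℚ._< y - x) (ℚP.+-inverseʳ x) (ℚP.+-monoˡ-< (- x) x<y)

0≤-⇒≤ : ∀ {x y} → 0ℚ ℚ.≤ y - x → x ℚ.≤ y
0≤-⇒≤ {x} {y} 0≤d = ≤-by (y - x) 0≤d (solve 2 (λ x y → x :+ (y :- x) := y) refl x y)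

0≤+ : ∀ {x y} → 0ℚ ℚ.≤ x → 0ℚ ℚ.≤ y → 0ℚ ℚ.≤ x + y
0≤+ = ℚP.+-mono-≤

0<+ : ∀ {x y} → 0ℚ ℚ.< x → 0ℚ ℚ.≤ y → 0ℚ ℚ.< x + y
0<+ = ℚP.+-mono-<-≤

0≤* : ∀ {x y} → 0ℚ ℚ.≤ x → 0ℚ ℚ.≤ y → 0ℚ ℚ.≤ x * y
0≤* {x} {y} 0≤x 0≤y = subst (ℚ._≤ x * y) (ℚP.*-zeroʳ x)
  (ℚP.*-monoˡ-≤-nonNeg x {{ℚ.nonNegative 0≤x}} 0≤y)

0<* : ∀ {x y} → 0ℚ ℚ.< x → 0ℚ ℚ.< y → 0ℚ ℚ.< x * y
0<* {x} {y} 0<x 0<y = subst (ℚ._< x * y) (ℚP.*-zeroʳ x)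
  (ℚP.*-monoʳ-<-pos x {{ℚ.positive 0<x}} 0<y)

0≤neg : ∀ {x} → x ℚ.≤ 0ℚ → 0ℚ ℚ.≤ - x
0≤neg = ℚP.neg-antimono-≤

0<neg : ∀ {x} → x ℚ.< 0ℚ → 0ℚ ℚ.< - x
0<neg = ℚP.neg-antimono-<

0<1 : 0ℚ ℚ.< 1ℚ
0<1 = ℚP.positive⁻¹ 1ℚ

0≤1 : 0ℚ ℚ.≤ 1ℚ
0≤1 = ℚP.<⇒≤ 0<1

<⇒≢′ : ∀ {x} → 0ℚ ℚ.< x → x ≢ 0ℚ
<⇒≢′ 0<x refl = ℚP.<-irrefl refl 0<x

-- Total, so that formulas carry no evidence of non-zeroness. The value 0 at 0 is also what the
-- dilation factor t = 0 needs: it sends the only lattice point there to the origin.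
recip : ℚ → ℚ
recip x with x ℚP.≟ 0ℚ
... | yes _  = 0ℚ
... | no x≢0 = (ℚ.1/ x) {{ℚ.≢-nonZero x≢0}}

recip-inverse : ∀ x → x ≢ 0ℚ → x * recip x ≡ 1ℚ
recip-inverse x x≢0 with x ℚP.≟ 0ℚ
... | yes x≡0 = ⊥-elim (x≢0 x≡0)
... | no x≢0′ = ℚP.*-inverseʳ x {{ℚ.≢-nonZero x≢0′}}

0<recip : ∀ {x} → 0ℚ ℚ.< x → 0ℚ ℚ.< recip x
0<recip {x} 0<x with x ℚP.≟ 0ℚ
... | yes refl = ⊥-elim (ℚP.<-irrefl refl 0<x)
... | no x≢0 = ℚP.positive⁻¹ _ {{ℚP.1/pos⇒pos x {{ℚ.positive 0<x}}}}

0≤recip : ∀ {x} → 0ℚ ℚ.< x → 0ℚ ℚ.≤ recip x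
0≤recip = ℚP.<⇒≤ ∘ 0<recip

-- Finite sums of rationals

Σ-cong : ∀ m {f g : Fin m → ℚ} → (∀ j → f j ≡ g j) → Σℚ m f ≡ Σℚ m g
Σ-cong zero    _   = refl
Σ-cong (suc m) f≗g = cong₂ _+_ (f≗g zero) (Σ-cong m (f≗g ∘ suc))

Σ-zero : ∀ m → Σℚ m (λ _ → 0ℚ) ≡ 0ℚ
Σ-zero zero    = refl
Σ-zero (suc m) = trans (ℚP.+-identityˡ _) (Σ-zero m)

Σ-+ : ∀ m (f g : Fin m → ℚ) → Σℚ m (λ j → f j + g j) ≡ Σℚ m f + Σℚ m g
Σ-+ zero    f g = refl
Σ-+ (suc m) f g = trans (cong (f zero + g zero +_) (Σ-+ m (f ∘ suc) (g ∘ suc)))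
  (solve 4 (λ a b c d → (a :+ b) :+ (c :+ d) := (a :+ c) :+ (b :+ d)) refl
    (f zero) (g zero) (Σℚ m (f ∘ suc)) (Σℚ m (g ∘ suc)))

Σ-*ˡ : ∀ m x (f : Fin m → ℚ) → Σℚ m (λ j → x * f j) ≡ x * Σℚ m f
Σ-*ˡ zero    x f = sym (ℚP.*-zeroʳ x)
Σ-*ˡ (suc m) x f = trans (cong (x * f zero +_) (Σ-*ˡ m x (f ∘ suc))) (sym (ℚP.*-distribˡ-+ x _ _))

Σ-*ʳ : ∀ m x (f : Fin m → ℚ) → Σℚ m (λ j → f j * x) ≡ Σℚ m f * x
Σ-*ʳ m x f = trans (Σ-cong m (λ j → ℚP.*-comm (f j) x)) (trans (Σ-*ˡ m x f) (ℚP.*-comm x _))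

Σ-neg : ∀ m (f : Fin m → ℚ) → Σℚ m (λ j → - f j) ≡ - Σℚ m f
Σ-neg zero    f = refl
Σ-neg (suc m) f = trans (cong (- f zero +_) (Σ-neg m (f ∘ suc))) (sym (ℚP.neg-distrib-+ (f zero) _))

Σ-minus : ∀ m (f g : Fin m → ℚ) → Σℚ m (λ j → f j - g j) ≡ Σℚ m f - Σℚ m g
Σ-minus m f g = trans (Σ-+ m f (λ j → - g j)) (cong (Σℚ m f +_) (Σ-neg m g))

Σ-swap : ∀ m k (f : Fin m → Fin k → ℚ) →
  Σℚ m (λ i → Σℚ k (f i)) ≡ Σℚ k (λ j → Σℚ m (λ i → f i j))
Σ-swap zero    k f = sym (Σ-zero k)
Σ-swap (suc m) k f = trans (cong (Σℚ k (f zero) +_) (Σ-swap m k (f ∘ suc)))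
  (sym (Σ-+ k (f zero) (λ j → Σℚ m (λ i → f (suc i) j))))

Σ-mono : ∀ m {f g : Fin m → ℚ} → (∀ j → f j ℚ.≤ g j) → Σℚ m f ℚ.≤ Σℚ m g
Σ-mono zero    _   = ℚP.≤-refl
Σ-mono (suc m) f≤g = ℚP.+-mono-≤ (f≤g zero) (Σ-mono m (f≤g ∘ suc))

0≤Σ : ∀ m {f : Fin m → ℚ} → (∀ j → 0ℚ ℚ.≤ f j) → 0ℚ ℚ.≤ Σℚ m f
0≤Σ m {f} 0≤f = subst (ℚ._≤ Σℚ m f) (Σ-zero m) (Σ-mono m 0≤f)

0<Σ : ∀ m {f : Fin m → ℚ} → (∀ j → 0ℚ ℚ.≤ f j) → ∀ i → 0ℚ ℚ.< f i → 0ℚ ℚ.< Σℚ m f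
0<Σ (suc m) 0≤f zero    0<f = 0<+ 0<f (0≤Σ m (0≤f ∘ suc))
0<Σ (suc m) 0≤f (suc i) 0<f = ℚP.+-mono-≤-< (0≤f zero) (0<Σ m (0≤f ∘ suc) i 0<f)

-- Written exactly as the entries of `𝟏 u`, so that `lookup∘tabulate` is all it takes to pass
-- between vectors and functions.
δ : ∀ {n} → Fin n → Fin n → ℚ
δ i u = if does (i Fin.≟ u) then 1ℚ else 0ℚ

0≤δ : ∀ {n} (i u : Fin n) → 0ℚ ℚ.≤ δ i u
0≤δ i u with does (i Fin.≟ u)
... | true  = 0≤1
... | false = ℚP.≤-refl

δ-diag : ∀ {n} (i : Fin n) → δ i i ≡ 1ℚ
δ-diag zero    = refl
δ-diag (suc i) = δ-diag i

δ-off : ∀ {n} {i u : Fin n} → i ≢ u → δ i u ≡ 0ℚ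
δ-off {i = i} {u} i≢u with i Fin.≟ u
... | yes i≡u = ⊥-elim (i≢u i≡u)
... | no _    = refl

δ-sym : ∀ {n} (i u : Fin n) → δ i u ≡ δ u i
δ-sym zero    zero    = refl
δ-sym zero    (suc u) = refl
δ-sym (suc i) zero    = refl
δ-sym (suc i) (suc u) = δ-sym i u

Σ-δ : ∀ n (u : Fin n) (f : Fin n → ℚ) → Σℚ n (λ i → f i * δ i u) ≡ f u
Σ-δ (suc n) zero    f = trans (cong₂ _+_ (ℚP.*-identityʳ (f zero))
    (trans (Σ-cong n (λ i → ℚP.*-zeroʳ (f (suc i)))) (Σ-zero n))) (ℚP.+-identityʳ _)
Σ-δ (suc n) (suc u) f = trans (cong₂ _+_ (ℚP.*-zeroʳ (f zero)) (Σ-δ n u (f ∘ suc))) (ℚP.+-identityˡ _)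

Σ-δ′ : ∀ n (u : Fin n) (f : Fin n → ℚ) → Σℚ n (λ i → f i * δ u i) ≡ f u
Σ-δ′ n u f = trans (Σ-cong n (λ i → cong (f i *_) (δ-sym u i))) (Σ-δ n u f)

-- Linear programming over ℚ

-- Stands for the inequality 0 ≤ Σ coef·c + slope·s + constant. The objective `s` is kept apart from
-- the variables `c` because it must survive when they are eliminated one by one.
record Constraint (k : ℕ) : Set where
  constructor constraint
  field
    coef     : Fin k → ℚ
    slope    : ℚ
    constant : ℚ
open Constraint

eval : ∀ {k} → Constraint k → ℚ → (Fin k → ℚ) → ℚ
eval {k} R s c = Σℚ k (λ j → coef R j * c j) + (slope R * s + constant R)

-- A record rather than a function, so that the arguments are inferable without unfolding ℚ arithmetic.
record Satisfies {k} (Rs : List (Constraint k)) (s : ℚ) (c : Fin k → ℚ) : Set where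
  constructor satisfies
  field
    holds : ∀ R → R ∈ Rs → 0ℚ ℚ.≤ eval R s c
open Satisfies

cons : ∀ {k} → ℚ → (Fin k → ℚ) → Fin (suc k) → ℚ
cons y c zero    = y
cons y c (suc j) = c j

lead : ∀ {k} → Constraint (suc k) → ℚ
lead R = coef R zero

dropLead : ∀ {k} → Constraint (suc k) → Constraint k
dropLead R = constraint (coef R ∘ suc) (slope R) (constant R)

eval-lead : ∀ {k} (R : Constraint (suc k)) s c →
  eval R s c ≡ lead R * c zero + eval (dropLead R) s (c ∘ suc)
eval-lead R s c = ℚP.+-assoc (lead R * c zero) _ _

linear : ∀ {k} → ℚ → ℚ → Constraint k → Constraint k → Constraint k
linear x y P N = constraint (λ j → x * coef P j + y * coef N j)
  (x * slope P + y * slope N) (x * constant P + y * constant N)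

eval-linear : ∀ {k} x y (P N : Constraint k) s c →
  eval (linear x y P N) s c ≡ x * eval P s c + y * eval N s c
eval-linear {k} x y P N s c = begin
  Σℚ k (λ j → (x * coef P j + y * coef N j) * c j) + affine
    ≡⟨ cong (_+ affine) (Σ-cong k λ j →
         solve 5 (λ x p y n c → (x :* p :+ y :* n) :* c := x :* (p :* c) :+ y :* (n :* c)) refl
           x (coef P j) y (coef N j) (c j)) ⟩
  Σℚ k (λ j → x * (coef P j * c j) + y * (coef N j * c j)) + affine
    ≡⟨ cong (_+ affine) (Σ-+ k _ _) ⟩
  Σℚ k (λ j → x * (coef P j * c j)) + Σℚ k (λ j → y * (coef N j * c j)) + affine
    ≡⟨ cong (_+ affine) (cong₂ _+_ (Σ-*ˡ k x _) (Σ-*ˡ k y _)) ⟩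
  x * SP + y * SN + affine
    ≡⟨ solve 9 (λ x y sp sn pp pn rp rn s →
         x :* sp :+ y :* sn :+ ((x :* pp :+ y :* pn) :* s :+ (x :* rp :+ y :* rn))
         := x :* (sp :+ (pp :* s :+ rp)) :+ y :* (sn :+ (pn :* s :+ rn))) refl
       x y SP SN (slope P) (slope N) (constant P) (constant N) s ⟩
  x * eval P s c + y * eval N s c ∎
  where
  open ≡-Reasoning
  affine = (x * slope P + y * slope N) * s + (x * constant P + y * constant N)
  SP = Σℚ k (λ j → coef P j * c j)
  SN = Σℚ k (λ j → coef N j * c j)

-- With `lead P` positive and `lead N` negative both multipliers are positive, and they are chosen
-- to cancel the leading variable.
combine : ∀ {k} → Constraint (suc k) → Constraint (suc k) → Constraint k
combine P N = linear (- lead N) (lead P) (dropLead P) (dropLead N)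

positives negatives zeros : ∀ {k} → List (Constraint (suc k)) → List (Constraint (suc k))
positives = filter (λ R → 0ℚ ℚP.<? lead R)
negatives = filter (λ R → lead R ℚP.<? 0ℚ)
zeros     = filter (λ R → lead R ℚP.≟ 0ℚ)

-- One step of Fourier–Motzkin elimination.
eliminate : ∀ {k} → List (Constraint (suc k)) → List (Constraint k)
eliminate Rs = map dropLead (zeros Rs) ++ cartesianProductWith combine (positives Rs) (negatives Rs)

eliminate-holds : ∀ {k} (Rs : List (Constraint (suc k))) s c → Satisfies Rs s c →
  ∀ R → R ∈ eliminate Rs → 0ℚ ℚ.≤ eval R s (c ∘ suc)
eliminate-holds Rs s c (satisfies sat) R R∈ with ∈-++⁻ (map dropLead (zeros Rs)) R∈
... | inj₁ R∈z with ∈-map⁻ dropLead R∈z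
...   | Z , Z∈ , refl with ∈-filter⁻ (λ R → lead R ℚP.≟ 0ℚ) {xs = Rs} Z∈
...     | Z∈Rs , Z≡0 = subst (0ℚ ℚ.≤_) eq (sat Z Z∈Rs)
  where
  eq : eval Z s c ≡ eval (dropLead Z) s (c ∘ suc)
  eq = trans (eval-lead Z s c) (trans
    (cong (λ l → l * c zero + eval (dropLead Z) s (c ∘ suc)) Z≡0)
    (trans (cong (_+ eval (dropLead Z) s (c ∘ suc)) (ℚP.*-zeroˡ (c zero))) (ℚP.+-identityˡ _)))
eliminate-holds Rs s c (satisfies sat) R R∈ | inj₂ R∈c
  with ∈-cartesianProductWith⁻ combine (positives Rs) (negatives Rs) R∈c
... | P , N , P∈ , N∈ , refl
  with ∈-filter⁻ (λ R → 0ℚ ℚP.<? lead R) {xs = Rs} P∈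
     | ∈-filter⁻ (λ R → lead R ℚP.<? 0ℚ) {xs = Rs} N∈
... | P∈Rs , 0<P | N∈Rs , N<0 = subst (0ℚ ℚ.≤_) eq
  (0≤+ (0≤* (0≤neg (ℚP.<⇒≤ N<0)) (sat P P∈Rs)) (0≤* (ℚP.<⇒≤ 0<P) (sat N N∈Rs)))
  where
  open ≡-Reasoning
  EP = eval (dropLead P) s (c ∘ suc)
  EN = eval (dropLead N) s (c ∘ suc)
  eq : - lead N * eval P s c + lead P * eval N s c ≡ eval (combine P N) s (c ∘ suc)
  eq = begin
    - lead N * eval P s c + lead P * eval N s c
      ≡⟨ cong₂ (λ a b → - lead N * a + lead P * b) (eval-lead P s c) (eval-lead N s c) ⟩
    - lead N * (lead P * c zero + EP) + lead P * (lead N * c zero + EN)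
      ≡⟨ solve 5 (λ n p y ep en → (:- n) :* (p :* y :+ ep) :+ p :* (n :* y :+ en)
           := (:- n) :* ep :+ p :* en) refl (lead N) (lead P) (c zero) EP EN ⟩
    - lead N * EP + lead P * EN
      ≡⟨ eval-linear (- lead N) (lead P) (dropLead P) (dropLead N) s (c ∘ suc) ⟨
    eval (combine P N) s (c ∘ suc) ∎

eliminate-sound : ∀ {k} (Rs : List (Constraint (suc k))) s c →
  Satisfies Rs s c → Satisfies (eliminate Rs) s (c ∘ suc)
eliminate-sound Rs s c sat = satisfies (eliminate-holds Rs s c sat)

lowerBound : {A : Set} (u : A → ℚ) (ys : List A) → ∃ λ m → ∀ {y} → y ∈ ys → m ℚ.≤ u y
lowerBound u [] = 0ℚ , λ ()
lowerBound u (y ∷ ys) with lowerBound u ys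
... | m , lb = u y ℚ.⊓ m , λ where
  (here refl) → ℚP.p⊓q≤p (u y) m
  (there y∈)  → ℚP.≤-trans (ℚP.p⊓q≤q (u y) m) (lb y∈)

-- Supplies the value of an eliminated variable: the maximum of all its lower bounds, started from
-- some number below every upper bound so that it exists even when there are no lower bounds.
separate : {A B : Set} (l : A → ℚ) (u : B → ℚ) (xs : List A) (ys : List B) →
  (∀ {x y} → x ∈ xs → y ∈ ys → l x ℚ.≤ u y) →
  ∃ λ m → (∀ {x} → x ∈ xs → l x ℚ.≤ m) × (∀ {y} → y ∈ ys → m ℚ.≤ u y)
separate l u [] ys l≤u with lowerBound u ys
... | m , lb = m , (λ ()) , lb
separate l u (x ∷ xs) ys l≤u with separate l u xs ys (l≤u ∘ there)
... | m , xs≤m , m≤ys = l x ℚ.⊔ m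
  , (λ where
      (here refl) → ℚP.p≤p⊔q (l x) m
      (there x∈)  → ℚP.≤-trans (xs≤m x∈) (ℚP.p≤q⊔p (l x) m))
  , (λ y∈ → ℚP.⊔-lub (l≤u (here refl) y∈) (m≤ys y∈))

-- A constraint with positive leading coefficient bounds the missing variable from below by `l`, one
-- with negative leading coefficient from above by `u`. The combined constraints say precisely that
-- every lower bound is at most every upper bound.
eliminate-complete : ∀ {k} (Rs : List (Constraint (suc k))) s c →
  Satisfies (eliminate Rs) s c → ∃ λ y → Satisfies Rs s (cons y c)
eliminate-complete {k} Rs s c (satisfies sat) = y , satisfies sat′
  where
  E : Constraint (suc k) → ℚ
  E R = eval (dropLead R) s c

  l u : Constraint (suc k) → ℚ
  l P = - E P * recip (lead P)
  u N = E N * recip (- lead N)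

  l≤u : ∀ {P N} → P ∈ positives Rs → N ∈ negatives Rs → l P ℚ.≤ u N
  -- The gap between `l P` and `u N` is the combined constraint of `P` and `N` divided by the
  -- product p n of the positive multipliers.
  l≤u {P} {N} P∈ N∈ = ≤-by ((recip p * recip n) * (n * E P + p * E N))
    (0≤* (0≤* (0≤recip 0<p) (0≤recip 0<n))
      (subst (0ℚ ℚ.≤_) (eval-linear n p (dropLead P) (dropLead N) s c)
        (sat _ (∈-++⁺ʳ (map dropLead (zeros Rs)) (∈-cartesianProductWith⁺ combine P∈ N∈)))))
    (begin
      - E P * recip p + (recip p * recip n) * (n * E P + p * E N)
        ≡⟨ solve 6 (λ p n p′ n′ ep en →
             (:- ep) :* p′ :+ (p′ :* n′) :* (n :* ep :+ p :* en)
             := (:- ep) :* p′ :+ (p′ :* (n :* n′) :* ep :+ n′ :* (p :* p′) :* en)) refl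
             p n (recip p) (recip n) (E P) (E N) ⟩
      - E P * recip p + (recip p * (n * recip n) * E P + recip n * (p * recip p) * E N)
        ≡⟨ cong₂ (λ a b → - E P * recip p + (recip p * a * E P + recip n * b * E N))
             (recip-inverse n (<⇒≢′ 0<n)) (recip-inverse p (<⇒≢′ 0<p)) ⟩
      - E P * recip p + (recip p * 1ℚ * E P + recip n * 1ℚ * E N)
        ≡⟨ solve 4 (λ p′ n′ ep en →
             (:- ep) :* p′ :+ (p′ :* con 1ℚ :* ep :+ n′ :* con 1ℚ :* en) := en :* n′) refl
             (recip p) (recip n) (E P) (E N) ⟩
      E N * recip n ∎)
    where
    open ≡-Reasoning
    p = lead P
    n = - lead N
    0<p : 0ℚ ℚ.< p
    0<p = proj₂ (∈-filter⁻ (λ R → 0ℚ ℚP.<? lead R) {xs = Rs} P∈)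
    0<n : 0ℚ ℚ.< n
    0<n = 0<neg (proj₂ (∈-filter⁻ (λ R → lead R ℚP.<? 0ℚ) {xs = Rs} N∈))

  between : ∃ λ m → (∀ {P} → P ∈ positives Rs → l P ℚ.≤ m) × (∀ {N} → N ∈ negatives Rs → m ℚ.≤ u N)
  between = separate l u (positives Rs) (negatives Rs) l≤u

  y = proj₁ between

  sat′ : ∀ R → R ∈ Rs → 0ℚ ℚ.≤ eval R s (cons y c)
  sat′ R R∈ = subst (0ℚ ℚ.≤_) (sym (eval-lead R s (cons y c))) (by-sign (ℚP.<-cmp 0ℚ (lead R)))
    where
    open ≡-Reasoning
    r = lead R
    by-sign : _ → 0ℚ ℚ.≤ r * y + E R
    by-sign (tri< 0<r _ _) = subst (0ℚ ℚ.≤_) eq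
      (0≤* (ℚP.<⇒≤ 0<r) (≤⇒0≤- (proj₁ (proj₂ between) (∈-filter⁺ (λ R → 0ℚ ℚP.<? lead R) R∈ 0<r))))
      where
      eq : r * (y - - E R * recip r) ≡ r * y + E R
      eq = begin
        r * (y - - E R * recip r)
          ≡⟨ solve 4 (λ r y e r′ → r :* (y :- (:- e) :* r′) := r :* y :+ e :* (r :* r′)) refl r y (E R) (recip r) ⟩
        r * y + E R * (r * recip r) ≡⟨ cong (λ a → r * y + E R * a) (recip-inverse r (<⇒≢′ 0<r)) ⟩
        r * y + E R * 1ℚ ≡⟨ cong (r * y +_) (ℚP.*-identityʳ (E R)) ⟩
        r * y + E R ∎
    by-sign (tri≈ _ 0≡r _) = subst (0ℚ ℚ.≤_) eq
      (sat _ (∈-++⁺ˡ (∈-map⁺ dropLead (∈-filter⁺ (λ R → lead R ℚP.≟ 0ℚ) R∈ (sym 0≡r)))))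
      where
      eq : E R ≡ r * y + E R
      eq = sym (trans (cong (λ a → a * y + E R) (sym 0≡r))
        (trans (cong (_+ E R) (ℚP.*-zeroˡ y)) (ℚP.+-identityˡ (E R))))
    by-sign (tri> _ _ r<0) = subst (0ℚ ℚ.≤_) eq
      (0≤* (ℚP.<⇒≤ (0<neg r<0)) (≤⇒0≤- (proj₂ (proj₂ between) (∈-filter⁺ (λ R → lead R ℚP.<? 0ℚ) R∈ r<0))))
      where
      eq : - r * (E R * recip (- r) - y) ≡ r * y + E R
      eq = begin
        - r * (E R * recip (- r) - y)
          ≡⟨ solve 4 (λ r y e r′ → (:- r) :* (e :* r′ :- y) := r :* y :+ e :* ((:- r) :* r′)) refl r y (E R) (recip (- r)) ⟩
        r * y + E R * (- r * recip (- r)) ≡⟨ cong (λ a → r * y + E R * a) (recip-inverse (- r) (<⇒≢′ (0<neg r<0))) ⟩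
        r * y + E R * 1ℚ ≡⟨ cong (r * y +_) (ℚP.*-identityʳ (E R)) ⟩
        r * y + E R ∎

Minimal : (ℚ → Set) → ℚ → Set
Minimal F s = F s × (∀ s′ → F s′ → s ℚ.≤ s′)

Feasible : ∀ {k} → List (Constraint k) → ℚ → Set
Feasible Rs s = ∃ λ c → Satisfies Rs s c

eval₀ : ∀ (R : Constraint 0) s c → eval R s c ≡ slope R * s + constant R
eval₀ R s c = ℚP.+-identityˡ (slope R * s + constant R)

falling : ∀ {p q r s} → p ℚ.≤ 0ℚ → r ℚ.≤ s → 0ℚ ℚ.≤ p * s + q → 0ℚ ℚ.≤ p * r + q
falling {p} {q} {r} {s} p≤0 r≤s 0≤e = ℚP.≤-trans 0≤e (≤-by (- p * (s - r))
  (0≤* (0≤neg p≤0) (≤⇒0≤- r≤s))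
  (solve 4 (λ p q r s → p :* s :+ q :+ (:- p) :* (s :- r) := p :* r :+ q) refl p q r s))

rising : ∀ p q → 0ℚ ℚ.< p →
  ∃ λ b → (∀ s → b ℚ.≤ s → 0ℚ ℚ.≤ p * s + q) × (∀ s → 0ℚ ℚ.≤ p * s + q → b ℚ.≤ s)
rising p q 0<p = b
  , (λ s b≤s → subst (0ℚ ℚ.≤_) (at s) (0≤* (ℚP.<⇒≤ 0<p) (≤⇒0≤- b≤s)))
  , (λ s 0≤e → 0≤-⇒≤ (ℚP.*-cancelˡ-≤-pos p {{ℚ.positive 0<p}}
      (subst₂ ℚ._≤_ (sym (ℚP.*-zeroʳ p)) (sym (at s)) 0≤e)))
  where
  b = - q * recip p
  at : ∀ s → p * (s - b) ≡ p * s + q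
  at s = begin
    p * (s - - q * recip p)
      ≡⟨ solve 4 (λ p q s p′ → p :* (s :- (:- q) :* p′) := p :* s :+ q :* (p :* p′)) refl p q s (recip p) ⟩
    p * s + q * (p * recip p) ≡⟨ cong (λ a → p * s + q * a) (recip-inverse p (<⇒≢′ 0<p)) ⟩
    p * s + q * 1ℚ ≡⟨ cong (p * s +_) (ℚP.*-identityʳ q) ⟩
    p * s + q ∎
    where open ≡-Reasoning

-- Shape of the feasible set to the left of a feasible `s₀` once no variables remain. Feasibility of
-- the whole segment from `s` to `s₀` is recorded, not just of `s`, so that a further constraint may
-- move the left end to a larger value.
HalfLine : List (Constraint 0) → (Fin 0 → ℚ) → ℚ → Set
HalfLine Rs c s₀ =
  (∃ λ s → s ℚ.≤ s₀ × (∀ r → s ℚ.≤ r → r ℚ.≤ s₀ → Satisfies Rs r c)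
                    × (∀ r → Satisfies Rs r c → s ℚ.≤ r)) ⊎
  (∀ r → r ℚ.≤ s₀ → Satisfies Rs r c)

satisfies-∷ : ∀ {R : Constraint 0} {Rs s c} → 0ℚ ℚ.≤ slope R * s + constant R →
  Satisfies Rs s c → Satisfies (R ∷ Rs) s c
satisfies-∷ {R} {s = s} {c} R-holds sat = satisfies λ where
  _ (here refl) → subst (0ℚ ℚ.≤_) (sym (eval₀ R s c)) R-holds
  R′ (there R∈) → holds sat R′ R∈

satisfies-head : ∀ {R : Constraint 0} {Rs s c} → Satisfies (R ∷ Rs) s c → 0ℚ ℚ.≤ slope R * s + constant R
satisfies-head {R} {s = s} {c} sat = subst (0ℚ ℚ.≤_) (eval₀ R s c) (holds sat R (here refl))

satisfies-tail : ∀ {k} {R : Constraint k} {Rs s c} → Satisfies (R ∷ Rs) s c → Satisfies Rs s c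
satisfies-tail sat = satisfies λ R R∈ → holds sat R (there R∈)

halfLine-∷ : ∀ R Rs c s₀ → 0ℚ ℚ.≤ slope R * s₀ + constant R → HalfLine Rs c s₀ →
  Dec (0ℚ ℚ.< slope R) → HalfLine (R ∷ Rs) c s₀
halfLine-∷ R Rs c s₀ 0≤e (inj₁ (s , s≤s₀ , above , min)) (no p≯0) = inj₁ (s , s≤s₀
  , (λ r s≤r r≤s₀ → satisfies-∷ (falling (ℚP.≮⇒≥ p≯0) r≤s₀ 0≤e) (above r s≤r r≤s₀))
  , λ r sat-r → min r (satisfies-tail sat-r))
halfLine-∷ R Rs c s₀ 0≤e (inj₂ below) (no p≯0) =
  inj₂ λ r r≤s₀ → satisfies-∷ (falling (ℚP.≮⇒≥ p≯0) r≤s₀ 0≤e) (below r r≤s₀)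
halfLine-∷ R Rs c s₀ 0≤e rest (yes 0<p) = raise rest
  where
  root = rising (slope R) (constant R) 0<p
  b = proj₁ root
  b-holds = proj₁ (proj₂ root)
  b-bound = proj₂ (proj₂ root)
  bound : ∀ r → Satisfies (R ∷ Rs) r c → b ℚ.≤ r
  bound r sat-r = b-bound r (satisfies-head sat-r)
  raise : HalfLine Rs c s₀ → HalfLine (R ∷ Rs) c s₀
  raise (inj₂ below) = inj₁ (b , b-bound s₀ 0≤e
    , (λ r b≤r r≤s₀ → satisfies-∷ (b-holds r b≤r) (below r r≤s₀))
    , bound)
  raise (inj₁ (s , s≤s₀ , above , min)) = inj₁ (s ℚ.⊔ b , ℚP.⊔-lub s≤s₀ (b-bound s₀ 0≤e)
    , (λ r m≤r r≤s₀ → satisfies-∷ (b-holds r (ℚP.≤-trans (ℚP.p≤q⊔p s b) m≤r))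
        (above r (ℚP.≤-trans (ℚP.p≤p⊔q s b) m≤r) r≤s₀))
    , λ r sat-r → ℚP.⊔-lub (min r (satisfies-tail sat-r)) (bound r sat-r))

halfLine : (Rs : List (Constraint 0)) (c : Fin 0 → ℚ) → ∀ s₀ → Satisfies Rs s₀ c → HalfLine Rs c s₀
halfLine [] c s₀ sat = inj₂ λ _ _ → satisfies λ _ ()
halfLine (R ∷ Rs) c s₀ sat = halfLine-∷ R Rs c s₀ (satisfies-head sat)
  (halfLine Rs c s₀ (satisfies-tail sat)) (0ℚ ℚP.<? slope R)

infimum : ∀ (Rs : List (Constraint 0)) {s₀ s₋ c} → s₋ ℚ.≤ s₀ → ¬ Feasible Rs s₋ → HalfLine Rs c s₀ →
  ∃ (Minimal (Feasible Rs))
infimum Rs {s₀} {s₋} {c} s₋≤s₀ ¬F (inj₂ below) = ⊥-elim (¬F (c , below s₋ s₋≤s₀))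
infimum Rs {s₀} {s₋} {c} s₋≤s₀ ¬F (inj₁ (s , s≤s₀ , above , min)) = s , (c , above s ℚP.≤-refl s≤s₀)
  -- `c` and `c′` are functions on the empty type; their evaluations are compared through `eval₀`
  -- instead of identifying the functions.
  , λ r (c′ , sat) → min r (satisfies λ R R∈ →
      subst (0ℚ ℚ.≤_) (trans (eval₀ R r c′) (sym (eval₀ R r c))) (holds sat R R∈))

-- Elimination preserves the set of feasible `s`, so the minimum can be sought after all variables
-- are gone. There all constraints are non-strict, hence the left end is attained, and the
-- infeasible `s₋` rules out a feasible set unbounded below.
minimum-attained : ∀ {k} (Rs : List (Constraint k)) s₀ s₋ → Feasible Rs s₀ → s₋ ℚ.≤ s₀ →
  ¬ Feasible Rs s₋ → ∃ (Minimal (Feasible Rs))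
minimum-attained {zero} Rs s₀ s₋ (c , sat) s₋≤s₀ ¬F = infimum Rs s₋≤s₀ ¬F (halfLine Rs c s₀ sat)
minimum-attained {suc k} Rs s₀ s₋ (c , sat) s₋≤s₀ ¬F = s
  , extend s (proj₁ (proj₂ rec))
  , λ r (c , sat) → proj₂ (proj₂ rec) r (c ∘ suc , eliminate-sound Rs r c sat)
  where
  extend : ∀ r → Feasible (eliminate Rs) r → Feasible Rs r
  extend r (c , sat) = cons (proj₁ (eliminate-complete Rs r c sat)) c , proj₂ (eliminate-complete Rs r c sat)
  rec : ∃ (Minimal (Feasible (eliminate Rs)))
  rec = minimum-attained (eliminate Rs) s₀ s₋ (c ∘ suc , eliminate-sound Rs s₀ c sat) s₋≤s₀ (¬F ∘ extend s₋)
  s = proj₁ rec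

-- Cheapest conic representations

comb : ∀ {m n} → (Fin m → ℚ) → (Fin m → Fin n → ℚ) → Fin n → ℚ
comb {m} c g i = Σℚ m (λ j → c j * g j i)

-- `s` is the cost. For the arcs of the graph, the least possible cost of `x` is the gauge of the
-- symmetric edge polytope at `x`.
record ConicRep {m n} (g : Fin m → Fin n → ℚ) (x : Fin n → ℚ) (s : ℚ) : Set where
  constructor conicRep
  field
    weight   : Fin m → ℚ
    weight≥0 : ∀ j → 0ℚ ℚ.≤ weight j
    total    : Σℚ m weight ≡ s
    sums     : ∀ i → x i ≡ comb weight g i
open ConicRep

rep-total≥0 : ∀ {m n} {g : Fin m → Fin n → ℚ} {x s} → ConicRep g x s → 0ℚ ℚ.≤ s
rep-total≥0 {m} (conicRep c c≥0 tot _) = subst (0ℚ ℚ.≤_) tot (0≤Σ m c≥0)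

module _ {m n} (g : Fin m → Fin n → ℚ) (x : Fin n → ℚ) where

  nonneg : Fin m → Constraint m
  nonneg j = constraint (δ j) 0ℚ 0ℚ

  above below : Fin n → Constraint m
  above i = constraint (λ j → g j i) 0ℚ (- x i)
  below i = constraint (λ j → - g j i) 0ℚ (x i)

  -- Bounds the total weight by `s` instead of fixing it; at the minimal `s` the bound is tight.
  budget : Constraint m
  budget = constraint (λ _ → - 1ℚ) 1ℚ 0ℚ

  repConstraints : List (Constraint m)
  repConstraints = budget ∷ tabulate nonneg ++ (tabulate above ++ tabulate below)

  eval-nonneg : ∀ s c j → eval (nonneg j) s c ≡ c j
  eval-nonneg s c j = trans
    (cong₂ _+_ (trans (Σ-cong m λ j′ → ℚP.*-comm (δ j j′) (c j′)) (Σ-δ′ m j c))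
      (solve 1 (λ s → con 0ℚ :* s :+ con 0ℚ := con 0ℚ) refl s))
    (ℚP.+-identityʳ (c j))

  eval-above : ∀ s c i → eval (above i) s c ≡ comb c g i - x i
  eval-above s c i = cong₂ _+_ (Σ-cong m λ j → ℚP.*-comm (g j i) (c j))
    (solve 2 (λ s x → con 0ℚ :* s :+ (:- x) := :- x) refl s (x i))

  eval-below : ∀ s c i → eval (below i) s c ≡ x i - comb c g i
  eval-below s c i = trans
    (cong₂ _+_
      (trans (Σ-cong m λ j → solve 2 (λ g c → (:- g) :* c := :- (c :* g)) refl (g j i) (c j)) (Σ-neg m _))
      (solve 2 (λ s x → con 0ℚ :* s :+ x := x) refl s (x i)))
    (ℚP.+-comm (- comb c g i) (x i))

  eval-budget : ∀ s c → eval budget s c ≡ s - Σℚ m c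
  eval-budget s c = trans
    (cong₂ _+_ (Σ-*ˡ m (- 1ℚ) c) (refl {x = 1ℚ * s + 0ℚ}))
    (solve 2 (λ s t → (:- con 1ℚ) :* t :+ (con 1ℚ :* s :+ con 0ℚ) := s :- t) refl s (Σℚ m c))

  -- Stated for an arbitrary predicate so that the case split does not normalise ℚ expressions.
  repConstraints-all : (P : Constraint m → Set) → P budget → (∀ j → P (nonneg j)) →
    (∀ i → P (above i)) → (∀ i → P (below i)) → ∀ R → R ∈ repConstraints → P R
  repConstraints-all P pb pn pa pl _ (here refl) = pb
  repConstraints-all P pb pn pa pl R (there R∈) with ∈-++⁻ (tabulate nonneg) R∈
  ... | inj₁ R∈n with ∈-tabulate⁻ R∈n
  ...   | j , refl = pn j
  repConstraints-all P pb pn pa pl R (there R∈) | inj₂ R∈al with ∈-++⁻ (tabulate above) R∈al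
  ...   | inj₁ R∈a with ∈-tabulate⁻ R∈a
  ...     | i , refl = pa i
  repConstraints-all P pb pn pa pl R (there R∈) | inj₂ R∈al | inj₂ R∈l with ∈-tabulate⁻ R∈l
  ...     | i , refl = pl i

  rep⇒feasible : ∀ {s} → ConicRep g x s → Feasible repConstraints s
  rep⇒feasible {s} (conicRep c c≥0 total sums) = c , satisfies (repConstraints-all
    (λ R → 0ℚ ℚ.≤ eval R s c)
    (subst (0ℚ ℚ.≤_) (sym (eval-budget s c)) (≤⇒0≤- (ℚP.≤-reflexive total)))
    (λ j → subst (0ℚ ℚ.≤_) (sym (eval-nonneg s c j)) (c≥0 j))
    (λ i → subst (0ℚ ℚ.≤_) (sym (eval-above s c i)) (≤⇒0≤- (ℚP.≤-reflexive (sums i))))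
    (λ i → subst (0ℚ ℚ.≤_) (sym (eval-below s c i)) (≤⇒0≤- (ℚP.≤-reflexive (sym (sums i))))))

  feasible⇒rep : ∀ {s} → Feasible repConstraints s → ∃ λ s′ → s′ ℚ.≤ s × ConicRep g x s′
  feasible⇒rep {s} (c , satisfies sat) = Σℚ m c
    , 0≤-⇒≤ (subst (0ℚ ℚ.≤_) (eval-budget s c) (sat _ (here refl)))
    , conicRep c
        (λ j → subst (0ℚ ℚ.≤_) (eval-nonneg s c j)
          (sat _ (there (∈-++⁺ˡ (∈-tabulate⁺ {f = nonneg} j)))))
        refl
        (λ i → ℚP.≤-antisym
          (0≤-⇒≤ (subst (0ℚ ℚ.≤_) (eval-above s c i)
            (sat _ (there (∈-++⁺ʳ (tabulate nonneg) (∈-++⁺ˡ (∈-tabulate⁺ {f = above} i)))))))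
          (0≤-⇒≤ (subst (0ℚ ℚ.≤_) (eval-below s c i)
            (sat _ (there (∈-++⁺ʳ (tabulate nonneg) (∈-++⁺ʳ (tabulate above) (∈-tabulate⁺ {f = below} i))))))))

  cheapest-rep : ∀ {s₀} → ConicRep g x s₀ → ∃ (Minimal (ConicRep g x))
  cheapest-rep {s₀} rep₀ = s
    -- The weights found have total at most `s`, and minimality gives the reverse inequality.
    , subst (ConicRep g x) (ℚP.≤-antisym (proj₁ (proj₂ found)) (minimal _ (proj₂ (proj₂ found)))) (proj₂ (proj₂ found))
    , minimal
    where
    -1<0 : - 1ℚ ℚ.< 0ℚ
    -1<0 = ℚP.negative⁻¹ (- 1ℚ)
    -- Costs are sums of non-negative weights, so any negative number would do in place of -1.
    infeasible : ¬ Feasible repConstraints (- 1ℚ)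
    infeasible f = ℚP.<-irrefl {0ℚ} refl
      (ℚP.≤-<-trans (rep-total≥0 (proj₂ (proj₂ rep))) (ℚP.≤-<-trans (proj₁ (proj₂ rep)) -1<0))
      where
      rep : ∃ λ s → s ℚ.≤ - 1ℚ × ConicRep g x s
      rep = feasible⇒rep f
    best : ∃ (Minimal (Feasible repConstraints))
    best = minimum-attained repConstraints s₀ (- 1ℚ) (rep⇒feasible rep₀)
      (ℚP.≤-trans (ℚP.<⇒≤ -1<0) (rep-total≥0 rep₀)) infeasible
    s : ℚ
    s = proj₁ best
    found : ∃ λ s′ → s′ ℚ.≤ s × ConicRep g x s′
    found = feasible⇒rep (proj₁ (proj₂ best))
    minimal : ∀ r → ConicRep g x r → s ℚ.≤ r
    minimal r rep = proj₂ (proj₂ best) r (rep⇒feasible rep)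

-- Connected components and fundamental cuts

count : (m : ℕ) → (Fin m → Bool) → ℕ
count zero    b = 0
count (suc m) b = (if b zero then 1 else 0) ℕ.+ count m (b ∘ suc)

count-all : ∀ m {b : Fin m → Bool} → (∀ u → b u ≡ true) → count m b ≡ m
count-all zero    _   = refl
count-all (suc m) all rewrite all zero = cong suc (count-all m (all ∘ suc))

count-none : ∀ m {b : Fin m → Bool} → (∀ u → b u ≡ false) → count m b ≡ 0
count-none zero    _    = refl
count-none (suc m) none rewrite none zero = count-none m (none ∘ suc)

indicator≤1 : ∀ b → (if b then 1 else 0) ≤ 1
indicator≤1 false = z≤n
indicator≤1 true  = s≤s z≤n

indicator-mono : ∀ {b b′} → (b ≡ true → b′ ≡ true) → (if b then 1 else 0) ≤ (if b′ then 1 else 0)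
indicator-mono {false} _ = z≤n
indicator-mono {true}  b⇒b′ rewrite b⇒b′ refl = s≤s z≤n

count≤ : ∀ m b → count m b ≤ m
count≤ zero    b = z≤n
count≤ (suc m) b = ℕP.+-mono-≤ (indicator≤1 (b zero)) (count≤ m (b ∘ suc))

count-mono : ∀ m {b b′ : Fin m → Bool} → (∀ u → b u ≡ true → b′ u ≡ true) → count m b ≤ count m b′
count-mono zero    _    = z≤n
count-mono (suc m) b⇒b′ = ℕP.+-mono-≤ (indicator-mono (b⇒b′ zero)) (count-mono m (b⇒b′ ∘ suc))

count-except : ∀ m (r : Fin m) {b b′ : Fin m → Bool} → (∀ u → u ≢ r → b u ≡ true → b′ u ≡ true) →
  count m b ≤ suc (count m b′)
count-except (suc m) zero {b} {b′} b⇒b′ = ℕP.+-mono-≤ (indicator≤1 (b zero))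
  (ℕP.≤-trans (count-mono m (λ u → b⇒b′ (suc u) (λ ()))) (ℕP.m≤n+m _ (if b′ zero then 1 else 0)))
count-except (suc m) (suc r) {b} {b′} b⇒b′ = ℕP.≤-trans
  (ℕP.+-mono-≤ (indicator-mono (b⇒b′ zero λ ()))
    (count-except m r (λ u u≢r → b⇒b′ (suc u) (u≢r ∘ λ { refl → refl }))))
  (ℕP.≤-reflexive (ℕP.+-suc (if b′ zero then 1 else 0) (count m (b′ ∘ suc))))

does-true : ∀ {n} {a b : Fin n} → a ≡ b → does (a Fin.≟ b) ≡ true
does-true {a = a} {b} a≡b = dec-true (a Fin.≟ b) a≡b

does-false : ∀ {n} {a b : Fin n} → a ≢ b → does (a Fin.≟ b) ≡ false
does-false {a = a} {b} a≢b = dec-false (a Fin.≟ b) a≢b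

does⇒ : ∀ {P : Set} (P? : Dec P) → does P? ≡ true → P
does⇒ (yes p) _ = p

false-does : ∀ {n} {a b : Fin n} → does (a Fin.≟ b) ≡ false → a ≢ b
false-does eq a≡b = case (trans (sym eq) (does-true a≡b)) of λ ()

merge : ∀ {n} → Fin n → Fin n → Fin n → Fin n
merge p q z = if does (z Fin.≟ p) then q else z

merge-hit : ∀ {n} (p q : Fin n) {z} → z ≡ p → merge p q z ≡ q
merge-hit p q z≡p rewrite does-true z≡p = refl

merge-miss : ∀ {n} (p q : Fin n) {z} → z ≢ p → merge p q z ≡ z
merge-miss p q z≢p rewrite does-false z≢p = refl

merge-target : ∀ {n} (p q : Fin n) → merge p q q ≡ q
merge-target p q with q Fin.≟ p
... | yes _ = refl
... | no _  = refl

merge-≡ : ∀ {n} (p q z w : Fin n) → merge p q z ≡ merge p q w →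
  z ≡ w ⊎ (z ≡ p × w ≡ q) ⊎ (z ≡ q × w ≡ p)
merge-≡ p q z w eq with z Fin.≟ p | w Fin.≟ p
... | yes z≡p | yes w≡p = inj₁ (trans z≡p (sym w≡p))
... | yes z≡p | no _    = inj₂ (inj₁ (z≡p , sym eq))
... | no _    | yes w≡p = inj₂ (inj₂ (eq , w≡p))
... | no _    | no _    = inj₁ eq

und-∷ : ∀ {n} {E : List (Arc n)} {e a b} → Und E a b → Und (e ∷ E) a b
und-∷ (inj₁ ab) = inj₁ (there ab)
und-∷ (inj₂ ba) = inj₂ (there ba)

-- The classes of the labelling are the connected components, each labelled by one of its members.
record Components {n} (E : List (Arc n)) : Set where
  field
    label        : Fin n → Fin n
    label-joined : ∀ {a b} → label a ≡ label b → Star (Und E) a b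
    label-arc    : ∀ {a b} → (a , b) ∈ E → label a ≡ label b
    label-idem   : ∀ a → label (label a) ≡ label a
    many-labels  : n ≤ length E ℕ.+ count n (λ u → does (label u Fin.≟ u))

  label-star : ∀ {a b} → Star (Und E) a b → label a ≡ label b
  label-star ε = refl
  label-star (inj₁ e ◅ path) = trans (label-arc e) (label-star path)
  label-star (inj₂ e ◅ path) = trans (sym (label-arc e)) (label-star path)

module _ {n} {a b : Fin n} {E : List (Arc n)} (C : Components E) where
  open Components C

  joinLabel : Fin n → Fin n
  joinLabel u = merge (label b) (label a) (label u)

  joinLabel-joined : ∀ {u w} → joinLabel u ≡ joinLabel w → Star (Und ((a , b) ∷ E)) u w
  joinLabel-joined {u} {w} eq with merge-≡ (label b) (label a) (label u) (label w) eq
  ... | inj₁ u≡w = Star.map und-∷ (label-joined u≡w)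
  ... | inj₂ (inj₁ (u≡b , w≡a)) =
    Star.map und-∷ (label-joined u≡b) ◅◅ inj₂ (here refl) ◅ Star.map und-∷ (label-joined (sym w≡a))
  ... | inj₂ (inj₂ (u≡a , w≡b)) =
    Star.map und-∷ (label-joined u≡a) ◅◅ inj₁ (here refl) ◅ Star.map und-∷ (label-joined (sym w≡b))

  joinLabel-arc : ∀ {u w} → (u , w) ∈ (a , b) ∷ E → joinLabel u ≡ joinLabel w
  joinLabel-arc (here refl) = trans (merge-target (label b) (label a)) (sym (merge-hit (label b) (label a) refl))
  joinLabel-arc (there e)   = cong (merge (label b) (label a)) (label-arc e)

  joinLabel-idem : ∀ u → joinLabel (joinLabel u) ≡ joinLabel u
  joinLabel-idem u with label u Fin.≟ label b
  ... | yes _ = trans (cong (merge (label b) (label a)) (label-idem a)) (merge-target (label b) (label a))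
  ... | no u≢b = trans (cong (merge (label b) (label a)) (label-idem u)) (merge-miss (label b) (label a) u≢b)

  -- The class of `b` adopts the label of the class of `a`, so only `label b` can stop being a root.
  -- A new arc therefore lowers the number of roots by at most one, which maintains `many-labels`.
  joinLabel-root : ∀ u → u ≢ label b → does (label u Fin.≟ u) ≡ true → does (joinLabel u Fin.≟ u) ≡ true
  joinLabel-root u u≢b root = does-true (trans
    (merge-miss (label b) (label a) (λ eq → u≢b (trans (sym u-root) eq))) u-root)
    where
    u-root : label u ≡ u
    u-root = does⇒ (label u Fin.≟ u) root

  join : Components ((a , b) ∷ E)
  join = record
    { label        = joinLabel
    ; label-joined = joinLabel-joined
    ; label-arc    = joinLabel-arc
    ; label-idem   = joinLabel-idem
    ; many-labels  = ℕP.≤-trans many-labels (ℕP.≤-trans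
        (ℕP.+-monoʳ-≤ (length E) (count-except n (label b) joinLabel-root))
        (ℕP.≤-reflexive (ℕP.+-suc (length E) _)))
    }

components : ∀ {n} (E : List (Arc n)) → Components E
components {n} [] = record
  { label        = id
  ; label-joined = λ { refl → ε }
  ; label-arc    = λ ()
  ; label-idem   = λ _ → refl
  ; many-labels  = ℕP.≤-reflexive (sym (count-all n (λ u → does-true {a = u} refl)))
  }
components (_ ∷ E) = join (components E)

∈-removeAt : ∀ {A : Set} {x : A} (xs : List A) j → x ∈ xs → x ≡ lookup xs j ⊎ x ∈ removeAt xs j
∈-removeAt (_ ∷ _)      zero    (here eq)  = inj₁ eq
∈-removeAt (_ ∷ _)      zero    (there x∈) = inj₂ x∈
∈-removeAt (_ ∷ _)      (suc j) (here eq)  = inj₂ (here eq)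
∈-removeAt (_ ∷ xs)     (suc j) (there x∈) with ∈-removeAt xs j x∈
... | inj₁ eq  = inj₁ eq
... | inj₂ x∈′ = inj₂ (there x∈′)

lookup∈removeAt : ∀ {A : Set} (xs : List A) {i j} → i ≢ j → lookup xs i ∈ removeAt xs j
lookup∈removeAt (_ ∷ xs) {zero}  {zero}  i≢j = ⊥-elim (i≢j refl)
lookup∈removeAt (_ ∷ xs) {zero}  {suc j} i≢j = here refl
lookup∈removeAt (_ ∷ xs) {suc i} {zero}  i≢j = ∈-lookup {xs = xs} i
lookup∈removeAt (_ ∷ xs) {suc i} {suc j} i≢j = there (lookup∈removeAt xs (i≢j ∘ cong suc))

record SpanningTree {n} (T : List (Arc n)) : Set where
  constructor spanningTree
  field
    connected : ∀ a b → Star (Und T) a b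
    size      : length T ≡ n ℕ.∸ 1

module FundamentalCut {n} {T : List (Arc n)} (tree : SpanningTree T) (j : Fin (length T)) where
  open SpanningTree tree
  open Components (components (removeAt T j))

  tail head : Fin n
  tail = proj₁ (lookup T j)
  head = proj₂ (lookup T j)

  private
    -- Only arc `j` can change the class, and a step along it ends at its head or its tail.
    step : ∀ {a b} → Und T a b → label a ≡ label b ⊎ (label b ≡ label head ⊎ label b ≡ label tail)
    step (inj₁ e) with ∈-removeAt T j e
    ... | inj₁ eq = inj₂ (inj₁ (cong (label ∘ proj₂) eq))
    ... | inj₂ e′ = inj₁ (label-arc e′)
    step (inj₂ e) with ∈-removeAt T j e
    ... | inj₁ eq = inj₂ (inj₂ (cong (label ∘ proj₁) eq))
    ... | inj₂ e′ = inj₁ (sym (label-arc e′))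

    two-labels′ : ∀ {a b} → Star (Und T) a b → label a ≡ label head ⊎ label a ≡ label tail →
      label b ≡ label head ⊎ label b ≡ label tail
    two-labels′ ε a = a
    two-labels′ (s ◅ path) a with step s
    ... | inj₂ b = two-labels′ path b
    ... | inj₁ eq with a
    ...   | inj₁ h = two-labels′ path (inj₁ (trans (sym eq) h))
    ...   | inj₂ t = two-labels′ path (inj₂ (trans (sym eq) t))

  two-labels : ∀ u → label u ≡ label head ⊎ label u ≡ label tail
  two-labels u = two-labels′ (connected head u) (inj₁ refl)

  -- Spanning trees are given by connectedness and number of arcs, so acyclicity is derived here.
  -- Were the ends still joined, a single component on n vertices would be left with n - 2 arcs,
  -- against `many-labels`.
  head≢tail : label head ≢ label tail
  head≢tail h≡t = ℕP.<-irrefl refl (begin-strict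
    length T                                              ≡⟨ size ⟩
    n ℕ.∸ 1                                               <⟨ ℕP.≤-reflexive (ℕP.suc-pred n {{nonZeroIndex head}}) ⟩
    n                                                     ≤⟨ many-labels ⟩
    length (removeAt T j) ℕ.+ count n (λ u → does (label u Fin.≟ u))
      ≤⟨ ℕP.+-monoʳ-≤ (length (removeAt T j)) one-root ⟩
    length (removeAt T j) ℕ.+ 1                           ≡⟨ ℕP.+-comm (length (removeAt T j)) 1 ⟩
    suc (length (removeAt T j))                           ≡⟨ cong suc (length-removeAt T j) ⟩
    suc (ℕ.pred (length T))                               ≡⟨ ℕP.suc-pred (length T) {{nonZeroIndex j}} ⟩
    length T                                              ∎)
    where
    open ℕP.≤-Reasoning
    all-head : ∀ u → label u ≡ label head
    all-head u with two-labels u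
    ... | inj₁ h = h
    ... | inj₂ t = trans t (sym h≡t)
    one-root : count n (λ u → does (label u Fin.≟ u)) ≤ 1
    one-root = subst (λ k → count n (λ u → does (label u Fin.≟ u)) ≤ suc k) (count-none n {λ _ → false} (λ _ → refl))
      (count-except n (label head) λ u u≢h root → ⊥-elim (u≢h (trans (sym (does⇒ (label u Fin.≟ u) root)) (all-head u))))

  -- Marks the head component of the fundamental cut, so arc `j` points away from `v` exactly when
  -- `side v` is `false`.
  side : Fin n → Bool
  side u = does (label u Fin.≟ label head)

  side-head : side head ≡ true
  side-head = does-true {a = label head} refl

  side-tail : side tail ≡ false
  side-tail = does-false (head≢tail ∘ sym)

  side-other : ∀ i → i ≢ j → side (proj₁ (lookup T i)) ≡ side (proj₂ (lookup T i))
  side-other i i≢j = cong (λ l → does (l Fin.≟ label head)) (label-arc (lookup∈removeAt T i≢j))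

  pointsAway⇒side : ∀ v → PointsAway T v j → side v ≡ false
  pointsAway⇒side v path = does-false λ v≡h → head≢tail (trans (sym v≡h) (label-star path))

  side⇒pointsAway : ∀ v → side v ≡ false → PointsAway T v j
  side⇒pointsAway v v∉ with two-labels v
  ... | inj₁ h = ⊥-elim (false-does {a = label v} v∉ h)
  ... | inj₂ t = label-joined t

-- Enumeration

private variable
  ℓ ℓ′ : Level
  A B : Set

hasCount-unique : {P : A → Set ℓ} {k k′ : ℕ} → HasCount P k → HasCount P k′ → k ≡ k′
hasCount-unique (L , uniq , mem , refl) (L′ , uniq′ , mem′ , refl) = ↭-length (∼bag⇒↭
  (unique∧set⇒bag uniq uniq′ λ {x} → mk⇔ (from (mem′ x) ∘ to (mem x)) (from (mem x) ∘ to (mem′ x))))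

hasCount-cong : {P : A → Set ℓ} {Q : A → Set ℓ′} {k : ℕ} →
  (∀ {x} → P x → Q x) → (∀ {x} → Q x → P x) → HasCount P k → HasCount Q k
hasCount-cong f g (L , uniq , mem , len) = L , uniq , (λ x → mk⇔ (f ∘ to (mem x)) (from (mem x) ∘ g)) , len

hasCount-∅ : {P : A → Set ℓ} → (∀ x → ¬ P x) → HasCount P 0
hasCount-∅ ¬P = [] , [] , (λ x → mk⇔ (λ ()) (⊥-elim ∘ ¬P x)) , refl

hasCount-⊎ : {P : A → Set ℓ} {Q : A → Set ℓ′} {j k : ℕ} → (∀ x → P x → ¬ Q x) →
  HasCount P j → HasCount Q k → HasCount (λ x → P x ⊎ Q x) (j ℕ.+ k)
hasCount-⊎ disj (L , uL , mL , refl) (M , uM , mM , refl) = L ++ M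
  , Unique.++⁺ uL uM (λ {x} (x∈L , x∈M) → disj x (to (mL x) x∈L) (to (mM x) x∈M))
  , (λ x → mk⇔ ([ inj₁ ∘ to (mL x) , inj₂ ∘ to (mM x) ]′ ∘ ∈-++⁻ L)
               [ ∈-++⁺ˡ ∘ from (mL x) , ∈-++⁺ʳ L ∘ from (mM x) ]′)
  , length-++ L

hasCount-image : {P : A → Set ℓ} {k : ℕ} (f : A → B) → (∀ {x y} → f x ≡ f y → x ≡ y) →
  HasCount P k → HasCount (λ y → ∃ λ x → P x × y ≡ f x) k
hasCount-image {P = P} f inj (L , uniq , mem , refl) = map f L , Unique.map⁺ inj uniq
  , (λ y → mk⇔ (λ y∈ → let x , x∈ , eq = ∈-map⁻ f y∈ in x , to (mem x) x∈ , eq)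
               (λ (x , px , eq) → subst (_∈ map f L) (sym eq) (∈-map⁺ f (from (mem x) px))))
  , length-map f L

hasCount-singleton : (a : A) → HasCount (_≡ a) 1
hasCount-singleton a = a ∷ [] , [] ∷ [] , (λ x → mk⇔ (λ { (here eq) → eq ; (there ()) }) here) , refl

hasCount-Fin : ∀ m (b : Fin m → Bool) → HasCount (λ i → b i ≡ true) (count m b)
hasCount-Fin zero    b = hasCount-∅ λ ()
hasCount-Fin (suc m) b = hasCount-cong
  (λ { (inj₁ (refl , b0)) → b0 ; (inj₂ (i , bi , refl)) → bi })
  (λ { {zero} b0 → inj₁ (refl , b0) ; {suc i} bi → inj₂ (i , bi , refl) })
  (hasCount-⊎ (λ { _ (refl , _) (_ , _ , ()) }) head
    (hasCount-image suc (λ { refl → refl }) (hasCount-Fin m (b ∘ suc))))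
  where
  head : HasCount (λ (i : Fin (suc m)) → i ≡ zero × b zero ≡ true) (if b zero then 1 else 0)
  head with b zero
  ... | true  = hasCount-cong (_, refl) proj₁ (hasCount-singleton zero)
  ... | false = hasCount-∅ λ { _ (_ , ()) }

Σℕ : (m : ℕ) → (Fin m → ℕ) → ℕ
Σℕ zero    f = 0
Σℕ (suc m) f = f zero ℕ.+ Σℕ m (f ∘ suc)

hasCount-⋃ : ∀ m {P : Fin m → A → Set ℓ} {k : Fin m → ℕ} → (∀ i j → i ≢ j → ∀ x → P i x → ¬ P j x) →
  (∀ i → HasCount (P i) (k i)) → HasCount (λ x → ∃ λ i → P i x) (Σℕ m k)
hasCount-⋃ zero    disj counts = hasCount-∅ λ { _ (() , _) }
hasCount-⋃ (suc m) disj counts = hasCount-cong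
  (λ { (inj₁ p) → zero , p ; (inj₂ (i , p)) → suc i , p })
  (λ { (zero , p) → inj₁ p ; (suc i , p) → inj₂ (i , p) })
  (hasCount-⊎ (λ { x p (j , q) → disj zero (suc j) (λ ()) x p q })
    (counts zero)
    (hasCount-⋃ m (λ i j i≢j → disj (suc i) (suc j) (i≢j ∘ λ { refl → refl })) (counts ∘ suc)))

-- Lattice points of the t-th dilate of a unimodular simplex with the facets marked by b removed;
-- the slack t − Σ x is the barycentric coordinate of the remaining vertex.
HalfOpen : ∀ m → (Fin m → Bool) → ℕ → Vec ℕ m → Set
HalfOpen m b t x = (∀ j → b j ≡ true → 1 ≤ Vec.lookup x j) × Vec.sum x ≤ t

-- `HalfOpen` with the first coordinate split off and its mark made a separate Boolean, so that the
-- marked and unmarked cases become two families of their own.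
HalfOpen∷ : ∀ m → Bool → (Fin m → Bool) → ℕ → Vec ℕ (suc m) → Set
HalfOpen∷ m c b t (x ∷ xs) =
  (c ≡ true → 1 ≤ x) × (∀ j → b j ≡ true → 1 ≤ Vec.lookup xs j) × x ℕ.+ Vec.sum xs ≤ t

sucHead : ∀ {m} → Vec ℕ (suc m) → Vec ℕ (suc m)
sucHead (x ∷ xs) = suc x ∷ xs

sucHead-injective : ∀ {m} {x y : Vec ℕ (suc m)} → sucHead x ≡ sucHead y → x ≡ y
sucHead-injective {x = _ ∷ _} {_ ∷ _} refl = refl

module _ (m : ℕ) (b : Fin m → Bool) (IH : ∀ t → HasCount (HalfOpen m b t) ((t ℕ.+ (m ℕ.∸ count m b)) C m)) where
  private
    K = count m b
    r = m ℕ.∸ K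

    suc∸ : suc m ℕ.∸ K ≡ suc r
    suc∸ = ℕP.+-∸-assoc 1 (count≤ m b)

    r<suc : r ℕ.< suc m
    r<suc = s≤s (ℕP.m∸n≤m m K)

  -- Pascal's rule. Points with first coordinate 0 are counted by `IH`; lowering a positive first
  -- coordinate by one gives the points for t - 1. At t = 0 only the first kind occurs, and the
  -- other Pascal term vanishes because r ≤ m.
  hasCount-closed : ∀ t → HasCount (HalfOpen∷ m false b t) ((t ℕ.+ (suc m ℕ.∸ K)) C suc m)
  hasCount-closed zero = subst (HasCount (HalfOpen∷ m false b zero)) eq
    (hasCount-cong (λ { (xs , (marked , s) , refl) → (λ ()) , marked , s })
      (λ { {zero ∷ xs} (_ , marked , s) → xs , (marked , s) , refl ; {suc _ ∷ xs} (_ , _ , ()) })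
      (hasCount-image (0 ∷_) (λ { refl → refl }) (IH zero)))
    where
    open ≡-Reasoning
    eq : r C m ≡ (suc m ℕ.∸ K) C suc m
    eq = begin
      r C m                   ≡⟨ ℕP.+-identityʳ (r C m) ⟨
      r C m ℕ.+ 0             ≡⟨ cong (r C m ℕ.+_) (k>n⇒nCk≡0 r<suc) ⟨
      r C m ℕ.+ r C suc m     ≡⟨ nCk+nC[k+1]≡[n+1]C[k+1] r m ⟩
      suc r C suc m           ≡⟨ cong (_C suc m) suc∸ ⟨
      (suc m ℕ.∸ K) C suc m   ∎
  hasCount-closed (suc t) = subst (HasCount (HalfOpen∷ m false b (suc t))) eq
    (hasCount-cong
      (λ { (inj₁ (xs , (marked , s) , refl)) → (λ ()) , marked , s
         ; (inj₂ (x ∷ xs , (_ , marked , s) , refl)) → (λ ()) , marked , s≤s s })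
      (λ { {zero ∷ xs} (_ , marked , s) → inj₁ (xs , (marked , s) , refl)
         ; {suc x ∷ xs} (_ , marked , s≤s s) → inj₂ (x ∷ xs , ((λ ()) , marked , s) , refl) })
      (hasCount-⊎ (λ { _ (_ , _ , refl) (_ ∷ _ , _ , ()) })
        (hasCount-image (0 ∷_) (λ { refl → refl }) (IH (suc t)))
        (hasCount-image sucHead sucHead-injective (hasCount-closed t))))
    where
    open ≡-Reasoning
    eq : (suc t ℕ.+ r) C m ℕ.+ (t ℕ.+ (suc m ℕ.∸ K)) C suc m ≡ (suc t ℕ.+ (suc m ℕ.∸ K)) C suc m
    eq rewrite suc∸ | sym (ℕP.+-suc t r) = nCk+nC[k+1]≡[n+1]C[k+1] (t ℕ.+ suc r) m

  -- Lowering the first coordinate by one removes its mark and one unit of t, which leads back to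
  -- the closed case. At t = 0 there are no points, and the binomial is 0 because r < m + 1.
  hasCount-open : ∀ t → HasCount (HalfOpen∷ m true b t) ((t ℕ.+ r) C suc m)
  hasCount-open zero = subst (HasCount (HalfOpen∷ m true b zero)) (sym (k>n⇒nCk≡0 r<suc))
    (hasCount-∅ λ { (zero ∷ xs) (1≤x , _) → ℕP.<-irrefl refl (1≤x refl) ; (suc _ ∷ xs) (_ , _ , ()) })
  hasCount-open (suc t) = subst (HasCount (HalfOpen∷ m true b (suc t))) eq
    (hasCount-cong
      (λ { (x ∷ xs , (_ , marked , s) , refl) → (λ _ → s≤s z≤n) , marked , s≤s s })
      (λ { {zero ∷ xs} (1≤x , _) → ⊥-elim (ℕP.<-irrefl refl (1≤x refl))
         ; {suc x ∷ xs} (_ , marked , s≤s s) → x ∷ xs , ((λ ()) , marked , s) , refl })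
      (hasCount-image sucHead sucHead-injective (hasCount-closed t)))
    where
    eq : (t ℕ.+ (suc m ℕ.∸ K)) C suc m ≡ (suc t ℕ.+ r) C suc m
    eq = cong (_C suc m) (trans (cong (t ℕ.+_) suc∸) (ℕP.+-suc t r))

hasCount-halfOpen : ∀ m (b : Fin m → Bool) t →
  HasCount (HalfOpen m b t) ((t ℕ.+ (m ℕ.∸ count m b)) C m)
hasCount-halfOpen zero b t = hasCount-cong
  (λ { refl → (λ ()) , z≤n }) (λ { {[]} _ → refl }) (hasCount-singleton [])
hasCount-halfOpen (suc m) b t = hasCount-cong
  (λ { {x ∷ xs} (head , tail , s) → (λ { zero → head ; (suc j) → tail j }) , s })
  (λ { {x ∷ xs} (marked , s) → marked zero , marked ∘ suc , s })
  (by-head (b zero))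
  where
  IH = hasCount-halfOpen m (b ∘ suc)
  by-head : ∀ c → HasCount (HalfOpen∷ m c (b ∘ suc) t)
    ((t ℕ.+ (suc m ℕ.∸ ((if c then 1 else 0) ℕ.+ count m (b ∘ suc)))) C suc m)
  by-head false = hasCount-closed m (b ∘ suc) IH t
  by-head true  = hasCount-open m (b ∘ suc) IH t

sum-applyUpTo-+ : ∀ n (f g : ℕ → ℕ) →
  sum (applyUpTo (λ k → f k ℕ.+ g k) n) ≡ sum (applyUpTo f n) ℕ.+ sum (applyUpTo g n)
sum-applyUpTo-+ zero    f g = refl
sum-applyUpTo-+ (suc n) f g = trans (cong (f 0 ℕ.+ g 0 ℕ.+_) (sum-applyUpTo-+ n (f ∘ suc) (g ∘ suc)))
  (interchange (f 0) (g 0) _ _)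

sum-applyUpTo-cong : ∀ n {f g : ℕ → ℕ} → (∀ k → f k ≡ g k) → sum (applyUpTo f n) ≡ sum (applyUpTo g n)
sum-applyUpTo-cong zero    _   = refl
sum-applyUpTo-cong (suc n) f≗g = cong₂ ℕ._+_ (f≗g 0) (sum-applyUpTo-cong n (f≗g ∘ suc))

sum-applyUpTo-0 : ∀ n → sum (applyUpTo (λ _ → 0) n) ≡ 0
sum-applyUpTo-0 zero    = refl
sum-applyUpTo-0 (suc n) = sum-applyUpTo-0 n

sum-applyUpTo-indicator : ∀ n i (f : ℕ → ℕ) → i ℕ.< n →
  sum (applyUpTo (λ k → (if does (i ℕ.≟ k) then 1 else 0) ℕ.* f k) n) ≡ f i
sum-applyUpTo-indicator (suc n) zero    f _ = trans
  (cong₂ ℕ._+_ (ℕP.*-identityˡ (f 0)) (sum-applyUpTo-0 n)) (ℕP.+-identityʳ (f 0))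
sum-applyUpTo-indicator (suc n) (suc i) f (s≤s i<n) = sum-applyUpTo-indicator n i (f ∘ suc) i<n

-- Double counting: the indices are grouped by their value under `κ`, and the bound on `κ` ensures
-- that every group is met by the summation range.
sum-by-value : ∀ N (κ : Fin N → ℕ) (f : ℕ → ℕ) n → (∀ a → κ a ℕ.< n) →
  sum (applyUpTo (λ k → count N (λ a → does (κ a ℕ.≟ k)) ℕ.* f k) n) ≡ Σℕ N (f ∘ κ)
sum-by-value zero    κ f n κ< = sum-applyUpTo-0 n
sum-by-value (suc N) κ f n κ< = begin
  sum (applyUpTo (λ k → (ind k ℕ.+ rest k) ℕ.* f k) n)
    ≡⟨ sum-applyUpTo-cong n (λ k → ℕP.*-distribʳ-+ (f k) (ind k) (rest k)) ⟩
  sum (applyUpTo (λ k → ind k ℕ.* f k ℕ.+ rest k ℕ.* f k) n)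
    ≡⟨ sum-applyUpTo-+ n (λ k → ind k ℕ.* f k) (λ k → rest k ℕ.* f k) ⟩
  sum (applyUpTo (λ k → ind k ℕ.* f k) n) ℕ.+ sum (applyUpTo (λ k → rest k ℕ.* f k) n)
    ≡⟨ cong₂ ℕ._+_ (sum-applyUpTo-indicator n (κ zero) f (κ< zero)) (sum-by-value N (κ ∘ suc) f n (κ< ∘ suc)) ⟩
  f (κ zero) ℕ.+ Σℕ N (f ∘ κ ∘ suc) ∎
  where
  open ≡-Reasoning
  ind rest : ℕ → ℕ
  ind k = if does (κ zero ℕ.≟ k) then 1 else 0
  rest k = count N (λ a → does (κ (suc a) ℕ.≟ k))

Σℕ-cong : ∀ N {f g : Fin N → ℕ} → (∀ a → f a ≡ g a) → Σℕ N f ≡ Σℕ N g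
Σℕ-cong zero    _   = refl
Σℕ-cong (suc N) f≗g = cong₂ ℕ._+_ (f≗g zero) (Σℕ-cong N (f≗g ∘ suc))

ehrhartSum-by-value : ∀ N (κ : Fin N → ℕ) (h : ℕ → ℕ) d t → (∀ a → κ a ≤ d) →
  (∀ k → h k ≡ count N (λ a → does (κ a ℕ.≟ k))) →
  ehrhartSum h d t ≡ Σℕ N (λ a → (t ℕ.+ (d ℕ.∸ κ a)) C d)
ehrhartSum-by-value N κ h d t κ≤d h≡ = begin
  sum (map (λ k → h k ℕ.* f k) (upTo (suc d)))   ≡⟨ cong sum (map-upTo _ (suc d)) ⟩
  sum (applyUpTo (λ k → h k ℕ.* f k) (suc d))    ≡⟨ sum-applyUpTo-cong (suc d) (λ k → cong (ℕ._* f k) (h≡ k)) ⟩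
  sum (applyUpTo (λ k → count N (λ a → does (κ a ℕ.≟ k)) ℕ.* f k) (suc d))
    ≡⟨ sum-by-value N κ f (suc d) (s≤s ∘ κ≤d) ⟩
  Σℕ N (f ∘ κ) ∎
  where
  open ≡-Reasoning
  f : ℕ → ℕ
  f k = (t ℕ.+ (d ℕ.∸ k)) C d

-- Integrality

-- Unnormalised fractions avoid the reduction to lowest terms hidden in `z / 1`. The second argument
-- of `mkℚᵘ` is the denominator minus one.
toℚᵘ-ℤ→ℚ : ∀ z → ℚ.toℚᵘ (ℤ→ℚ z) ℚᵘ.≃ ℚᵘ.mkℚᵘ z 0
toℚᵘ-ℤ→ℚ z = ℚP.toℚᵘ-fromℚᵘ (ℚᵘ.mkℚᵘ z 0)

ℤ→ℚ-+ : ∀ a b → ℤ→ℚ (a ℤ.+ b) ≡ ℤ→ℚ a + ℤ→ℚ b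
ℤ→ℚ-+ a b = ℚP.toℚᵘ-injective (begin
  ℚ.toℚᵘ (ℤ→ℚ (a ℤ.+ b))                     ≈⟨ toℚᵘ-ℤ→ℚ (a ℤ.+ b) ⟩
  ℚᵘ.mkℚᵘ (a ℤ.+ b) 0                        ≈⟨ ℚᵘ.*≡* (cong (ℤ._* ℤ.+ 1) (sym (cong₂ ℤ._+_ (ℤP.*-identityʳ a) (ℤP.*-identityʳ b)))) ⟩
  ℚᵘ.mkℚᵘ a 0 ℚᵘ.+ ℚᵘ.mkℚᵘ b 0               ≈⟨ ℚᵘP.+-cong (toℚᵘ-ℤ→ℚ a) (toℚᵘ-ℤ→ℚ b) ⟨
  ℚ.toℚᵘ (ℤ→ℚ a) ℚᵘ.+ ℚ.toℚᵘ (ℤ→ℚ b)         ≈⟨ ℚP.toℚᵘ-homo-+ (ℤ→ℚ a) (ℤ→ℚ b) ⟨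
  ℚ.toℚᵘ (ℤ→ℚ a + ℤ→ℚ b)                     ∎)
  where open ℚᵘP.≃-Reasoning

ℤ→ℚ-* : ∀ a b → ℤ→ℚ (a ℤ.* b) ≡ ℤ→ℚ a * ℤ→ℚ b
ℤ→ℚ-* a b = ℚP.toℚᵘ-injective (begin
  ℚ.toℚᵘ (ℤ→ℚ (a ℤ.* b))                     ≈⟨ toℚᵘ-ℤ→ℚ (a ℤ.* b) ⟩
  ℚᵘ.mkℚᵘ a 0 ℚᵘ.* ℚᵘ.mkℚᵘ b 0               ≈⟨ ℚᵘP.*-cong (toℚᵘ-ℤ→ℚ a) (toℚᵘ-ℤ→ℚ b) ⟨
  ℚ.toℚᵘ (ℤ→ℚ a) ℚᵘ.* ℚ.toℚᵘ (ℤ→ℚ b)         ≈⟨ ℚP.toℚᵘ-homo-* (ℤ→ℚ a) (ℤ→ℚ b) ⟨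
  ℚ.toℚᵘ (ℤ→ℚ a * ℤ→ℚ b)                     ∎)
  where open ℚᵘP.≃-Reasoning

ℤ→ℚ-mono : ∀ {a b} → a ℤ.≤ b → ℤ→ℚ a ℚ.≤ ℤ→ℚ b
ℤ→ℚ-mono {a} {b} a≤b = ℚP.toℚᵘ-cancel-≤ (begin
  ℚ.toℚᵘ (ℤ→ℚ a)  ≃⟨ toℚᵘ-ℤ→ℚ a ⟩
  ℚᵘ.mkℚᵘ a 0     ≤⟨ ℚᵘ.*≤* (ℤP.*-monoʳ-≤-nonNeg (ℤ.+ 1) a≤b) ⟩
  ℚᵘ.mkℚᵘ b 0     ≃⟨ toℚᵘ-ℤ→ℚ b ⟨
  ℚ.toℚᵘ (ℤ→ℚ b)  ∎)
  where open ℚᵘP.≤-Reasoning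

ℤ→ℚ-injective : ∀ {a b} → ℤ→ℚ a ≡ ℤ→ℚ b → a ≡ b
ℤ→ℚ-injective {a} {b} eq with ℚᵘP.≃-trans (ℚᵘP.≃-sym (toℚᵘ-ℤ→ℚ a))
                               (ℚᵘP.≃-trans (ℚᵘP.≃-reflexive (cong ℚ.toℚᵘ eq)) (toℚᵘ-ℤ→ℚ b))
... | ℚᵘ.*≡* a*1≡b*1 = trans (sym (ℤP.*-identityʳ a)) (trans a*1≡b*1 (ℤP.*-identityʳ b))

ℤ→ℚ-cancel : ∀ {a b} → ℤ→ℚ a ℚ.≤ ℤ→ℚ b → a ℤ.≤ b
ℤ→ℚ-cancel {a} {b} a≤b = by-total (ℤP.≤-total a b)
  where
  by-total : a ℤ.≤ b ⊎ b ℤ.≤ a → a ℤ.≤ b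
  by-total (inj₁ le) = le
  by-total (inj₂ ge) = ℤP.≤-reflexive (ℤ→ℚ-injective (ℚP.≤-antisym a≤b (ℤ→ℚ-mono ge)))

IsInt : ℚ → Set
IsInt x = ∃ λ z → x ≡ ℤ→ℚ z

isInt-+ : ∀ {x y} → IsInt x → IsInt y → IsInt (x + y)
isInt-+ (a , p) (b , q) = a ℤ.+ b , trans (cong₂ _+_ p q) (sym (ℤ→ℚ-+ a b))

isInt-* : ∀ {x y} → IsInt x → IsInt y → IsInt (x * y)
isInt-* (a , p) (b , q) = a ℤ.* b , trans (cong₂ _*_ p q) (sym (ℤ→ℚ-* a b))

isInt-0 : IsInt 0ℚ
isInt-0 = ℤ.+ 0 , refl

isInt-1 : IsInt 1ℚ
isInt-1 = ℤ.+ 1 , refl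

isInt-neg : ∀ {x} → IsInt x → IsInt (- x)
isInt-neg {x} int = subst IsInt (solve 1 (λ x → (:- con 1ℚ) :* x := :- x) refl x) (isInt-* (-[1+ 0 ] , refl) int)

isInt-Σ : ∀ m {f : Fin m → ℚ} → (∀ j → IsInt (f j)) → IsInt (Σℚ m f)
isInt-Σ zero    int = isInt-0
isInt-Σ (suc m) int = isInt-+ (int zero) (isInt-Σ m (int ∘ suc))

isInt-δ : ∀ {n} (i u : Fin n) → IsInt (δ i u)
isInt-δ i u with does (i Fin.≟ u)
... | true  = isInt-1
... | false = isInt-0

isInt-≤0⊎1≤ : ∀ {x} → IsInt x → x ℚ.≤ 0ℚ ⊎ 1ℚ ℚ.≤ x
isInt-≤0⊎1≤ (ℤ.+ zero   , x≡z) = inj₁ (ℚP.≤-reflexive x≡z)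
isInt-≤0⊎1≤ (ℤ.+ suc k  , x≡z) = inj₂ (subst (1ℚ ℚ.≤_) (sym x≡z) (ℤ→ℚ-mono {ℤ.+ 1} {ℤ.+ suc k} (ℤ.+≤+ (ℕ.s≤s ℕ.z≤n))))
isInt-≤0⊎1≤ (-[1+ k ] , x≡z) = inj₁ (subst (ℚ._≤ 0ℚ) (sym x≡z) (ℤ→ℚ-mono { -[1+ k ]} {ℤ.+ 0} ℤ.-≤+))

isInt-nonNeg : ∀ {x} → IsInt x → 0ℚ ℚ.≤ x → ∃ λ k → x ≡ ℕ→ℚ k
isInt-nonNeg (z , x≡z) 0≤x = by-sign z x≡z (ℤ→ℚ-cancel {ℤ.+ 0} {z} (subst (0ℚ ℚ.≤_) x≡z 0≤x))
  where
  by-sign : ∀ z → _ ≡ ℤ→ℚ z → ℤ.+ 0 ℤ.≤ z → ∃ λ k → _ ≡ ℕ→ℚ k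
  by-sign (ℤ.+ k) x≡k _ = k , x≡k

ℕ→ℚ-mono : ∀ a b → a ≤ b → ℕ→ℚ a ℚ.≤ ℕ→ℚ b
ℕ→ℚ-mono a b a≤b = ℤ→ℚ-mono (ℤ.+≤+ a≤b)

ℕ→ℚ-cancel : ∀ a b → ℕ→ℚ a ℚ.≤ ℕ→ℚ b → a ≤ b
ℕ→ℚ-cancel a b a≤b = ℤP.drop‿+≤+ (ℤ→ℚ-cancel {ℤ.+ a} {ℤ.+ b} a≤b)

ℕ→ℚ-injective : ∀ {a b} → ℕ→ℚ a ≡ ℕ→ℚ b → a ≡ b
ℕ→ℚ-injective {a} {b} eq = ℤP.+-injective (ℤ→ℚ-injective {ℤ.+ a} {ℤ.+ b} eq)

ℕ→ℚ-sum : ∀ {m} (x : Vec ℕ m) → ℕ→ℚ (Vec.sum x) ≡ Σℚ m (λ j → ℕ→ℚ (Vec.lookup x j))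
ℕ→ℚ-sum Vec.[]       = refl
ℕ→ℚ-sum (a Vec.∷ x) = trans (ℤ→ℚ-+ (ℤ.+ a) (ℤ.+ Vec.sum x)) (cong (ℕ→ℚ a +_) (ℕ→ℚ-sum x))

-- Arcs as vectors, and coordinates with respect to a tree

arcVec : ∀ {n} → Arc n → Fin n → ℚ
arcVec e i = δ i (proj₂ e) - δ i (proj₁ e)

arcVecs : ∀ {n} (es : List (Arc n)) → Fin (length es) → Fin n → ℚ
arcVecs es j = arcVec (lookup es j)

StrictRep : ∀ {m n} → (Fin m → Fin n → ℚ) → (Fin n → ℚ) → ℚ → Set
StrictRep g x s = Σ (ConicRep g x s) λ r → ∀ j → 0ℚ ℚ.< ConicRep.weight r j

Σ-cast : ∀ {m k} (eq : m ≡ k) (f : Fin k → ℚ) → Σℚ m (f ∘ Fin.cast eq) ≡ Σℚ k f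
Σ-cast {m} refl f = Σ-cong m (λ j → cong f (cast-is-id refl j))

lookup-map-cast : ∀ {A B : Set} (f : A → B) xs (j : Fin (length (map f xs))) →
  lookup (map f xs) j ≡ f (lookup xs (Fin.cast (length-map f xs) j))
lookup-map-cast f (x ∷ xs) zero    = refl
lookup-map-cast f (x ∷ xs) (suc j) = lookup-map-cast f xs j

module _ {n} (es : List (Arc n)) where
  private
    len : length (QVerts es) ≡ length es
    len = length-map _ es

  -- `QVerts` is a mapped list, so its positions agree with those of `es` only up to `length-map`;
  -- hence the casts in this module.
  lookup-QVerts : ∀ j i → Vec.lookup (lookup (QVerts es) j) i ≡ arcVecs es (Fin.cast len j) i
  lookup-QVerts j i = begin
    Vec.lookup (lookup (QVerts es) j) i
      ≡⟨ cong (λ p → Vec.lookup p i) (lookup-map-cast _ es j) ⟩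
    Vec.lookup (𝟏 (proj₂ e) -ᵥ 𝟏 (proj₁ e)) i
      ≡⟨ VecP.lookup-zipWith _-_ i (𝟏 (proj₂ e)) (𝟏 (proj₁ e)) ⟩
    Vec.lookup (𝟏 (proj₂ e)) i - Vec.lookup (𝟏 (proj₁ e)) i
      ≡⟨ cong₂ _-_ (VecP.lookup∘tabulate _ i) (VecP.lookup∘tabulate _ i) ⟩
    arcVec e i ∎
    where
    open ≡-Reasoning
    e = lookup es (Fin.cast len j)

  lincomb-QVerts : ∀ (c : Fin (length es) → ℚ) i →
    Vec.lookup (lincomb (length (QVerts es)) (c ∘ Fin.cast len) (lookup (QVerts es))) i ≡ comb c (arcVecs es) i
  lincomb-QVerts c i = begin
    Vec.lookup (lincomb (length (QVerts es)) (c ∘ Fin.cast len) (lookup (QVerts es))) i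
      ≡⟨ VecP.lookup∘tabulate _ i ⟩
    Σℚ (length (QVerts es)) (λ j → c (Fin.cast len j) * Vec.lookup (lookup (QVerts es) j) i)
      ≡⟨ Σ-cong (length (QVerts es)) (λ j → cong (c (Fin.cast len j) *_) (lookup-QVerts j i)) ⟩
    Σℚ (length (QVerts es)) ((λ j → c j * arcVecs es j i) ∘ Fin.cast len)
      ≡⟨ Σ-cast len (λ j → c j * arcVecs es j i) ⟩
    comb c (arcVecs es) i ∎
    where open ≡-Reasoning

  uncast : (c : Fin (length (QVerts es)) → ℚ) → Fin (length es) → ℚ
  uncast c = c ∘ Fin.cast (sym len)

  uncast-cast : ∀ c j → uncast c (Fin.cast len j) ≡ c j
  uncast-cast c j = cong c (cast-involutive (sym len) len j)

  conv⇒rep : ∀ {x} (c : Fin (length (QVerts es)) → ℚ) → (∀ j → 0ℚ ℚ.≤ c j) →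
    Σℚ (length (QVerts es)) c ≡ 1ℚ → x ≡ lincomb (length (QVerts es)) c (lookup (QVerts es)) →
    ConicRep (arcVecs es) (Vec.lookup x) 1ℚ
  conv⇒rep {x} c c≥0 total eq = conicRep (uncast c) (λ j → c≥0 (Fin.cast (sym len) j))
    (trans (Σ-cast (sym len) c) total)
    λ i → trans (trans (trans (cong (λ p → Vec.lookup p i) eq) (VecP.lookup∘tabulate _ i)) (trans
      (Σ-cong (length (QVerts es)) λ j → cong (_* Vec.lookup (lookup (QVerts es) j) i) (sym (uncast-cast c j)))
      (sym (VecP.lookup∘tabulate _ i)))) (lincomb-QVerts (uncast c) i)

  inConv⇒rep : ∀ {x} → InConv (QVerts es) x → ConicRep (arcVecs es) (Vec.lookup x) 1ℚ
  inConv⇒rep (c , c≥0 , total , eq) = conv⇒rep c c≥0 total eq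

  inRelInt⇒rep : ∀ {x} → InRelInt (QVerts es) x → StrictRep (arcVecs es) (Vec.lookup x) 1ℚ
  inRelInt⇒rep (c , c>0 , total , eq) =
    conv⇒rep c (ℚP.<⇒≤ ∘ c>0) total eq , λ j → c>0 (Fin.cast (sym len) j)

  rep⇒lincomb : ∀ {y} (r : ConicRep (arcVecs es) y 1ℚ) →
    Vec.tabulate y ≡ lincomb (length (QVerts es)) (ConicRep.weight r ∘ Fin.cast len) (lookup (QVerts es))
  rep⇒lincomb (conicRep c c≥0 total sums) = VecP.tabulate-cong λ i →
    trans (sums i) (trans (sym (lincomb-QVerts c i)) (VecP.lookup∘tabulate _ i))

  rep⇒inConv : ∀ {y} → ConicRep (arcVecs es) y 1ℚ → InConv (QVerts es) (Vec.tabulate y)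
  rep⇒inConv r = ConicRep.weight r ∘ Fin.cast len , (λ j → ConicRep.weight≥0 r (Fin.cast len j))
    , trans (Σ-cast len (ConicRep.weight r)) (ConicRep.total r) , rep⇒lincomb r

  rep⇒inRelInt : ∀ {y} → StrictRep (arcVecs es) y 1ℚ → InRelInt (QVerts es) (Vec.tabulate y)
  rep⇒inRelInt (r , w>0) = ConicRep.weight r ∘ Fin.cast len , (λ j → w>0 (Fin.cast len j))
    , trans (Σ-cast len (ConicRep.weight r)) (ConicRep.total r) , rep⇒lincomb r

module TreeBasis {n} {T : List (Arc n)} (tree : SpanningTree T) where
  open SpanningTree tree

  d = length T

  basis : Fin d → Fin n → ℚ
  basis = arcVecs T

  side : Fin d → Fin n → Bool
  side j = FundamentalCut.side tree j

  χ : Fin d → Fin n → ℚ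
  χ j u = if side j u then 1ℚ else 0ℚ

  -- The net amount of `x` in the head component of the cut at `j`. These functionals are dual to
  -- the arcs of the tree, and their 0/1 coefficients are what makes the arcs a lattice basis.
  coord : Fin d → (Fin n → ℚ) → ℚ
  coord j x = Σℚ n (λ u → x u * χ j u)

  -- Arc `j` enters the head component of its own cut, while every other arc of the tree stays
  -- within one component.
  χ-arc : ∀ k j → χ j (proj₂ (lookup T k)) - χ j (proj₁ (lookup T k)) ≡ δ k j
  χ-arc k j = by-cases (k Fin.≟ j)
    where
    ind : Bool → ℚ
    ind b = if b then 1ℚ else 0ℚ
    by-cases : Dec (k ≡ j) → _
    by-cases (yes refl) = trans
      (cong₂ (λ a b → ind a - ind b) (FundamentalCut.side-head tree k) (FundamentalCut.side-tail tree k))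
      (sym (δ-diag k))
    by-cases (no k≢j) = trans
      (cong (λ a → ind (side j (proj₂ (lookup T k))) - ind a) (FundamentalCut.side-other tree j k k≢j))
      (trans (ℚP.+-inverseʳ (χ j (proj₂ (lookup T k)))) (sym (δ-off k≢j)))

  coord-cong : ∀ j {x y} → (∀ u → x u ≡ y u) → coord j x ≡ coord j y
  coord-cong j eq = Σ-cong n (λ u → cong (_* χ j u) (eq u))

  coord-+ : ∀ j x y → coord j (λ u → x u + y u) ≡ coord j x + coord j y
  coord-+ j x y = trans (Σ-cong n (λ u → ℚP.*-distribʳ-+ (χ j u) (x u) (y u)))
    (Σ-+ n (λ u → x u * χ j u) (λ u → y u * χ j u))

  coord-* : ∀ j a x → coord j (λ u → a * x u) ≡ a * coord j x
  coord-* j a x = trans (Σ-cong n (λ u → ℚP.*-assoc a (x u) (χ j u))) (Σ-*ˡ n a (λ u → x u * χ j u))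

  coord-arc : ∀ j (e : Arc n) → coord j (arcVec e) ≡ χ j (proj₂ e) - χ j (proj₁ e)
  coord-arc j (t , h) = begin
    Σℚ n (λ u → (δ u h - δ u t) * χ j u)
      ≡⟨ Σ-cong n (λ u → solve 3 (λ a b c → (a :- b) :* c := c :* a :- c :* b) refl (δ u h) (δ u t) (χ j u)) ⟩
    Σℚ n (λ u → χ j u * δ u h - χ j u * δ u t)
      ≡⟨ Σ-minus n (λ u → χ j u * δ u h) (λ u → χ j u * δ u t) ⟩
    Σℚ n (λ u → χ j u * δ u h) - Σℚ n (λ u → χ j u * δ u t)
      ≡⟨ cong₂ _-_ (Σ-δ n h (χ j)) (Σ-δ n t (χ j)) ⟩
    χ j h - χ j t ∎
    where open ≡-Reasoning

  coord-basis : ∀ j k → coord j (basis k) ≡ δ k j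
  coord-basis j k = trans (coord-arc j (lookup T k)) (χ-arc k j)

  coord-comb : ∀ j c → coord j (comb c basis) ≡ c j
  coord-comb j c = begin
    Σℚ n (λ u → Σℚ d (λ k → c k * basis k u) * χ j u)
      ≡⟨ Σ-cong n (λ u → sym (Σ-*ʳ d (χ j u) (λ k → c k * basis k u))) ⟩
    Σℚ n (λ u → Σℚ d (λ k → c k * basis k u * χ j u))
      ≡⟨ Σ-swap n d (λ u k → c k * basis k u * χ j u) ⟩
    Σℚ d (λ k → Σℚ n (λ u → c k * basis k u * χ j u))
      ≡⟨ Σ-cong d (λ k → coord-* j (c k) (basis k)) ⟩
    Σℚ d (λ k → c k * coord j (basis k))
      ≡⟨ Σ-cong d (λ k → cong (c k *_) (coord-basis j k)) ⟩
    Σℚ d (λ k → c k * δ k j)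
      ≡⟨ Σ-δ d j c ⟩
    c j ∎
    where open ≡-Reasoning

  private
    -- The tree expansion formally attached to the unit vector at `u`. It differs from that unit
    -- vector by a vector independent of `u`, because the difference does not change along any arc
    -- of the tree.
    W : Fin n → Fin n → ℚ
    W u i = Σℚ d (λ j → χ j u * basis j i)

    W-arc : ∀ {t h} → (t , h) ∈ T → ∀ i → W h i - δ i h ≡ W t i - δ i t
    W-arc {t} {h} e∈ i = begin
      W h i - δ i h
        ≡⟨ solve 4 (λ wh wt h t → wh :- h := (wh :- wt) :+ (wt :- h)) refl (W h i) (W t i) (δ i h) (δ i t) ⟩
      (W h i - W t i) + (W t i - δ i h)
        ≡⟨ cong (_+ (W t i - δ i h)) difference ⟩
      (δ i h - δ i t) + (W t i - δ i h)
        ≡⟨ solve 3 (λ wt h t → (h :- t) :+ (wt :- h) := wt :- t) refl (W t i) (δ i h) (δ i t) ⟩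
      W t i - δ i t ∎
      where
      open ≡-Reasoning
      k = Any.index e∈
      e≡ : (t , h) ≡ lookup T k
      e≡ = lookup-index e∈
        where open import Data.List.Relation.Unary.Any.Properties using (lookup-index)
      difference : W h i - W t i ≡ δ i h - δ i t
      difference = begin
        W h i - W t i
          ≡⟨ Σ-minus d (λ j → χ j h * basis j i) (λ j → χ j t * basis j i) ⟨
        Σℚ d (λ j → χ j h * basis j i - χ j t * basis j i)
          ≡⟨ Σ-cong d (λ j → solve 3 (λ a b c → a :* c :- b :* c := c :* (a :- b)) refl (χ j h) (χ j t) (basis j i)) ⟩
        Σℚ d (λ j → basis j i * (χ j h - χ j t))
          ≡⟨ Σ-cong d (λ j → cong (λ e → basis j i * (χ j (proj₂ e) - χ j (proj₁ e))) e≡) ⟩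
        Σℚ d (λ j → basis j i * (χ j (proj₂ (lookup T k)) - χ j (proj₁ (lookup T k))))
          ≡⟨ Σ-cong d (λ j → cong (basis j i *_) (χ-arc k j)) ⟩
        Σℚ d (λ j → basis j i * δ k j)
          ≡⟨ Σ-δ′ d k (λ j → basis j i) ⟩
        arcVec (lookup T k) i
          ≡⟨ cong (λ e → arcVec e i) e≡ ⟨
        δ i h - δ i t ∎

    W-star : ∀ {a b} → Star (Und T) a b → ∀ i → W b i - δ i b ≡ W a i - δ i a
    W-star ε i = refl
    W-star (inj₁ e ◅ path) i = trans (W-star path i) (W-arc e i)
    W-star (inj₂ e ◅ path) i = trans (W-star path i) (sym (W-arc e i))

  -- Exchanging the sums gives Σ x_u `W u`. Each `W u` is the unit vector at `u` plus a common
  -- vector, whose entry at `i` is `z`, and the common part cancels because the entries of `x` sum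
  -- to zero.
  basis-spans : ∀ x → Σℚ n x ≡ 0ℚ → ∀ i → x i ≡ comb (λ j → coord j x) basis i
  basis-spans x Σx≡0 i = sym (begin
    Σℚ d (λ j → coord j x * basis j i)
      ≡⟨ Σ-cong d (λ j → sym (Σ-*ʳ n (basis j i) (λ u → x u * χ j u))) ⟩
    Σℚ d (λ j → Σℚ n (λ u → x u * χ j u * basis j i))
      ≡⟨ Σ-swap d n (λ j u → x u * χ j u * basis j i) ⟩
    Σℚ n (λ u → Σℚ d (λ j → x u * χ j u * basis j i))
      ≡⟨ Σ-cong n (λ u → trans (Σ-cong d (λ j → ℚP.*-assoc (x u) (χ j u) (basis j i)))
           (Σ-*ˡ d (x u) (λ j → χ j u * basis j i))) ⟩
    Σℚ n (λ u → x u * W u i)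
      ≡⟨ Σ-cong n (λ u → cong (x u *_) (trans
           (solve 2 (λ w d → w := (w :- d) :+ d) refl (W u i) (δ i u))
           (cong (_+ δ i u) (W-star (connected i u) i)))) ⟩
    Σℚ n (λ u → x u * (z + δ i u))
      ≡⟨ Σ-cong n (λ u → ℚP.*-distribˡ-+ (x u) z (δ i u)) ⟩
    Σℚ n (λ u → x u * z + x u * δ i u)
      ≡⟨ Σ-+ n (λ u → x u * z) (λ u → x u * δ i u) ⟩
    Σℚ n (λ u → x u * z) + Σℚ n (λ u → x u * δ i u)
      ≡⟨ cong₂ _+_ (trans (Σ-*ʳ n z x) (trans (cong (_* z) Σx≡0) (ℚP.*-zeroˡ z))) (Σ-δ′ n i x) ⟩
    0ℚ + x i
      ≡⟨ ℚP.+-identityˡ (x i) ⟩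
    x i ∎)
    where
    open ≡-Reasoning
    z = W i i - δ i i

  isInt-coord : ∀ j {x} → (∀ u → IsInt (x u)) → IsInt (coord j x)
  isInt-coord j int = isInt-Σ n λ u → isInt-* (int u) (isInt-χ (side j u))
    where
    isInt-χ : ∀ b → IsInt (if b then 1ℚ else 0ℚ)
    isInt-χ true  = isInt-1
    isInt-χ false = isInt-0

-- Conic representations

comb-+ : ∀ {m n} (c c′ : Fin m → ℚ) (g : Fin m → Fin n → ℚ) i →
  comb (λ j → c j + c′ j) g i ≡ comb c g i + comb c′ g i
comb-+ {m} c c′ g i = trans (Σ-cong m (λ j → ℚP.*-distribʳ-+ (g j i) (c j) (c′ j)))
  (Σ-+ m (λ j → c j * g j i) (λ j → c′ j * g j i))

comb-* : ∀ {m n} a (c : Fin m → ℚ) (g : Fin m → Fin n → ℚ) i →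
  comb (λ j → a * c j) g i ≡ a * comb c g i
comb-* {m} a c g i = trans (Σ-cong m (λ j → ℚP.*-assoc a (c j) (g j i))) (Σ-*ˡ m a (λ j → c j * g j i))

comb-comb : ∀ {m k n} (c : Fin k → ℚ) (w : Fin k → Fin m → ℚ) (g : Fin m → Fin n → ℚ) i →
  comb (λ j → Σℚ k (λ l → c l * w l j)) g i ≡ Σℚ k (λ l → c l * comb (w l) g i)
comb-comb {m} {k} c w g i = begin
  Σℚ m (λ j → Σℚ k (λ l → c l * w l j) * g j i)
    ≡⟨ Σ-cong m (λ j → sym (Σ-*ʳ k (g j i) (λ l → c l * w l j))) ⟩
  Σℚ m (λ j → Σℚ k (λ l → c l * w l j * g j i))
    ≡⟨ Σ-swap m k (λ j l → c l * w l j * g j i) ⟩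
  Σℚ k (λ l → Σℚ m (λ j → c l * w l j * g j i))
    ≡⟨ Σ-cong k (λ l → comb-* (c l) (w l) g i) ⟩
  Σℚ k (λ l → c l * comb (w l) g i) ∎
  where open ≡-Reasoning

module _ {m n} {g : Fin m → Fin n → ℚ} where

  rep-cong : ∀ {x y s t} → (∀ i → x i ≡ y i) → s ≡ t → ConicRep g x s → ConicRep g y t
  rep-cong x≗y s≡t (conicRep c c≥0 tot eq) = conicRep c c≥0 (trans tot s≡t) (λ i → trans (sym (x≗y i)) (eq i))

  rep-zero : ConicRep g (λ _ → 0ℚ) 0ℚ
  rep-zero = conicRep (λ _ → 0ℚ) (λ _ → ℚP.≤-refl) (Σ-zero m)
    (λ i → sym (trans (Σ-cong m (λ j → ℚP.*-zeroˡ (g j i))) (Σ-zero m)))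

  rep-+ : ∀ {x y s t} → ConicRep g x s → ConicRep g y t → ConicRep g (λ i → x i + y i) (s + t)
  rep-+ (conicRep c c≥0 tot eq) (conicRep c′ c′≥0 tot′ eq′) = conicRep (λ j → c j + c′ j)
    (λ j → 0≤+ (c≥0 j) (c′≥0 j)) (trans (Σ-+ m c c′) (cong₂ _+_ tot tot′))
    (λ i → trans (cong₂ _+_ (eq i) (eq′ i)) (sym (comb-+ c c′ g i)))

  rep-* : ∀ {a x s} → 0ℚ ℚ.≤ a → ConicRep g x s → ConicRep g (λ i → a * x i) (a * s)
  rep-* {a} 0≤a (conicRep c c≥0 tot eq) = conicRep (λ j → a * c j)
    (λ j → 0≤* 0≤a (c≥0 j)) (trans (Σ-*ˡ m a c) (cong (a *_) tot))
    (λ i → trans (cong (a *_) (eq i)) (sym (comb-* a c g i)))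

  strictRep-* : ∀ {a x s} → 0ℚ ℚ.< a → StrictRep g x s → StrictRep g (λ i → a * x i) (a * s)
  strictRep-* 0<a (r , w>0) = rep-* (ℚP.<⇒≤ 0<a) r , λ j → 0<* 0<a (w>0 j)

  rep-self : ∀ j → ConicRep g (g j) 1ℚ
  rep-self j = conicRep (δ j) (0≤δ j)
    (trans (Σ-cong m (λ k → sym (ℚP.*-identityˡ (δ j k)))) (Σ-δ′ m j (λ _ → 1ℚ)))
    (λ i → sym (trans (Σ-cong m (λ k → ℚP.*-comm (δ j k) (g k i))) (Σ-δ′ m j (λ k → g k i))))

  -- Substituting representations of cost 1 for the generators keeps the cost, which makes costs
  -- over a tree comparable with costs over the whole graph.
  rep-trans : ∀ {k x s} {b : Fin k → Fin n → ℚ} → (∀ l → ConicRep g (b l) 1ℚ) → ConicRep b x s → ConicRep g x s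
  rep-trans {k} {x} {s} {b} reps (conicRep c c≥0 tot eq) = conicRep (λ j → Σℚ k (λ l → c l * weight (reps l) j))
    (λ j → 0≤Σ k (λ l → 0≤* (c≥0 l) (weight≥0 (reps l) j)))
    total′
    (λ i → trans (eq i) (trans (Σ-cong k (λ l → cong (c l *_) (sums (reps l) i)))
      (sym (comb-comb c (weight ∘ reps) g i))))
    where
    open ≡-Reasoning
    total′ : Σℚ m (λ j → Σℚ k (λ l → c l * weight (reps l) j)) ≡ s
    total′ = begin
      Σℚ m (λ j → Σℚ k (λ l → c l * weight (reps l) j))
        ≡⟨ Σ-swap m k (λ j l → c l * weight (reps l) j) ⟩
      Σℚ k (λ l → Σℚ m (λ j → c l * weight (reps l) j))
        ≡⟨ Σ-cong k (λ l → trans (Σ-*ˡ m (c l) (weight (reps l))) (trans (cong (c l *_) (total (reps l))) (ℚP.*-identityʳ (c l)))) ⟩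
      Σℚ k c
        ≡⟨ tot ⟩
      s ∎

  rep-total0 : ∀ {x} → ConicRep g x 0ℚ → ∀ i → x i ≡ 0ℚ
  rep-total0 (conicRep c c≥0 tot eq) i = trans (eq i)
    (trans (Σ-cong m (λ j → trans (cong (_* g j i) (c≡0 j)) (ℚP.*-zeroˡ (g j i)))) (Σ-zero m))
    where
    c≡0 : ∀ j → c j ≡ 0ℚ
    c≡0 j = ℚP.≤-antisym (ℚP.≮⇒≥ λ 0<c → <⇒≢′ (0<Σ m c≥0 j 0<c) tot) (c≥0 j)

  -- Since the generators sum to zero, all weights can be shifted by a common amount.
  module Balanced (balanced : ∀ i → Σℚ m (λ j → g j i) ≡ 0ℚ) where

    size : ℚ
    size = Σℚ m (λ _ → 1ℚ)

    size>0 : Fin m → 0ℚ ℚ.< size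
    size>0 j = 0<Σ m (λ _ → 0≤1) j 0<1

    shift-total : ∀ (c : Fin m → ℚ) a → Σℚ m (λ j → c j + a) ≡ Σℚ m c + a * size
    shift-total c a = trans (Σ-+ m c (λ _ → a)) (cong (Σℚ m c +_)
      (trans (Σ-cong m (λ _ → sym (ℚP.*-identityʳ a))) (Σ-*ˡ m a (λ _ → 1ℚ))))

    shift-comb : ∀ (c : Fin m → ℚ) a i → comb (λ j → c j + a) g i ≡ comb c g i
    shift-comb c a i = trans (comb-+ c (λ _ → a) g i) (trans
      (cong (comb c g i +_) (trans (Σ-*ˡ m a (λ j → g j i)) (trans (cong (a *_) (balanced i)) (ℚP.*-zeroʳ a))))
      (ℚP.+-identityʳ (comb c g i)))

    shift : ∀ {x s} a (r : ConicRep g x s) → (∀ j → 0ℚ ℚ.≤ weight r j + a) → ConicRep g x (s + a * size)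
    shift a (conicRep c c≥0 tot eq) c+a≥0 = conicRep (λ j → c j + a) c+a≥0
      (trans (shift-total c a) (cong (_+ a * size) tot)) (λ i → trans (eq i) (sym (shift-comb c a i)))

    -- Adding (t - s)/size to every weight turns cost s into cost t. The `Fin m` argument witnesses
    -- that there is a generator, so `size` is not 0.
    fill : ∀ s t → Fin m → s + (t - s) * recip size * size ≡ t
    fill s t j = begin
      s + (t - s) * recip size * size
        ≡⟨ solve 4 (λ s t r z → s :+ (t :- s) :* r :* z := s :+ (t :- s) :* (z :* r)) refl s t (recip size) size ⟩
      s + (t - s) * (size * recip size)
        ≡⟨ cong (λ a → s + (t - s) * a) (recip-inverse size (<⇒≢′ (size>0 j))) ⟩
      s + (t - s) * 1ℚ
        ≡⟨ solve 2 (λ s t → s :+ (t :- s) :* con 1ℚ := t) refl s t ⟩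
      t ∎
      where open ≡-Reasoning

    pad : ∀ {x s t} → Fin m → s ℚ.≤ t → ConicRep g x s → ConicRep g x t
    pad {x} {s} {t} j s≤t r = rep-cong (λ _ → refl) (fill s t j)
      (shift ((t - s) * recip size) r
        (λ k → 0≤+ (weight≥0 r k) (0≤* (≤⇒0≤- s≤t) (0≤recip (size>0 j)))))

    -- The unspent 1 - s is shared equally among all generators, and every weight becomes positive:
    -- cost below 1 means relative interior.
    strictPad : ∀ {x s} → Fin m → s ℚ.< 1ℚ → ConicRep g x s → StrictRep g x 1ℚ
    strictPad {x} {s} j s<1 (conicRep c c≥0 tot eq) =
      conicRep (λ k → c k + a) (ℚP.<⇒≤ ∘ c+a>0)
        (trans (shift-total c a) (trans (cong (_+ a * size) tot) (fill s 1ℚ j)))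
        (λ i → trans (eq i) (sym (shift-comb c a i)))
      , c+a>0
      where
      a = (1ℚ - s) * recip size
      c+a>0 : ∀ k → 0ℚ ℚ.< c k + a
      c+a>0 k = ℚP.+-mono-≤-< (c≥0 k) (0<* (<⇒0<- s<1) (0<recip (size>0 j)))

    positive-bound : ∀ k (c : Fin k → ℚ) → (∀ j → 0ℚ ℚ.< c j) → ∃ λ a → 0ℚ ℚ.< a × (∀ j → a ℚ.≤ c j)
    positive-bound zero    c c>0 = 1ℚ , 0<1 , λ ()
    positive-bound (suc k) c c>0 = minimum (positive-bound k (c ∘ suc) (c>0 ∘ suc))
      where
      minimum : _ → ∃ λ a → 0ℚ ℚ.< a × (∀ j → a ℚ.≤ c j)
      minimum (a , a>0 , a≤) with ℚP.≤-total a (c zero)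
      ... | inj₁ a≤c = a , a>0 , λ { zero → a≤c ; (suc j) → a≤ j }
      ... | inj₂ c≤a = c zero , c>0 zero , λ { zero → ℚP.≤-refl ; (suc j) → ℚP.≤-trans c≤a (a≤ j) }

    -- Converse of `strictPad`: a positive lower bound on the weights can be subtracted from all of
    -- them without changing the point.
    cheaper : ∀ {x s} → Fin m → StrictRep g x s → ∃ λ t → t ℚ.< s × ConicRep g x t
    cheaper {x} {s} j (r , w>0) = s + - a * size
      , <-by (a * size) (0<* a>0 (size>0 j)) (solve 3 (λ s a z → s :+ (:- a) :* z :+ a :* z := s) refl s a size)
      , shift (- a) r (λ k → ≤⇒0≤- (a≤ k))
      where
      bound = positive-bound m (weight r) w>0
      a = proj₁ bound
      a>0 : 0ℚ ℚ.< a
      a>0 = proj₁ (proj₂ bound)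
      a≤ : ∀ k → a ℚ.≤ weight r k
      a≤ = proj₂ (proj₂ bound)

-- Sums over lists, and conic representations by the arcs of the graph

sumOver : {A : Set} → (A → ℚ) → List A → ℚ
sumOver f xs = Σℚ (length xs) (λ j → f (lookup xs j))

sumOver-++ : ∀ {A : Set} (f : A → ℚ) xs ys → sumOver f (xs ++ ys) ≡ sumOver f xs + sumOver f ys
sumOver-++ f []       ys = sym (ℚP.+-identityˡ (sumOver f ys))
sumOver-++ f (x ∷ xs) ys = trans (cong (f x +_) (sumOver-++ f xs ys)) (sym (ℚP.+-assoc (f x) (sumOver f xs) (sumOver f ys)))

sumOver-map : ∀ {A B : Set} (f : B → ℚ) (φ : A → B) xs → sumOver f (map φ xs) ≡ sumOver (f ∘ φ) xs
sumOver-map f φ []       = refl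
sumOver-map f φ (x ∷ xs) = cong (f (φ x) +_) (sumOver-map f φ xs)

sumOver-concatMap : ∀ {A B : Set} (f : B → ℚ) (φ : A → List B) xs →
  sumOver f (concatMap φ xs) ≡ sumOver (sumOver f ∘ φ) xs
sumOver-concatMap f φ []       = refl
sumOver-concatMap f φ (x ∷ xs) = trans (sumOver-++ f (φ x) (concatMap φ xs))
  (cong (sumOver f (φ x) +_) (sumOver-concatMap f φ xs))

sumOver-filter : ∀ {A : Set} {p} {P : Pred A p} (P? : Decidable P) (f : A → ℚ) xs →
  sumOver f (filter P? xs) ≡ sumOver (λ x → if does (P? x) then f x else 0ℚ) xs
sumOver-filter P? f []       = refl
sumOver-filter P? f (x ∷ xs) with does (P? x)
... | true  = cong (f x +_) (sumOver-filter P? f xs)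
... | false = trans (sumOver-filter P? f xs) (sym (ℚP.+-identityˡ _))

sumOver-tabulate : ∀ {A : Set} n (f : A → ℚ) (φ : Fin n → A) → sumOver f (tabulate φ) ≡ Σℚ n (f ∘ φ)
sumOver-tabulate zero    f φ = refl
sumOver-tabulate (suc n) f φ = cong (f (φ zero) +_) (sumOver-tabulate n f (φ ∘ suc))

sumOver-allPairs : ∀ n (f : Arc n → ℚ) → sumOver f (allPairs n) ≡ Σℚ n (λ u → Σℚ n (λ w → f (u , w)))
sumOver-allPairs n f = begin
  sumOver f (allPairs n)
    ≡⟨ sumOver-concatMap f (λ u → map (u ,_) (allFin n)) (allFin n) ⟩
  sumOver (λ u → sumOver f (map (u ,_) (allFin n))) (allFin n)
    ≡⟨ sumOver-tabulate n (λ u → sumOver f (map (u ,_) (allFin n))) id ⟩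
  Σℚ n (λ u → sumOver f (map (u ,_) (allFin n)))
    ≡⟨ Σ-cong n (λ u → trans (sumOver-map f (u ,_) (allFin n)) (sumOver-tabulate n (λ w → f (u , w)) id)) ⟩
  Σℚ n (λ u → Σℚ n (λ w → f (u , w))) ∎
  where open ≡-Reasoning

antisymmetric-sum : ∀ n (f : Fin n → Fin n → ℚ) → (∀ u w → f u w ≡ - f w u) →
  Σℚ n (λ u → Σℚ n (f u)) ≡ 0ℚ
antisymmetric-sum n f anti = begin
  S             ≡⟨ solve 1 (λ s → s := con ½ :* (s :+ s)) refl S ⟩
  ½ * (S + S)   ≡⟨ cong (λ a → ½ * (S + a)) S≡-S ⟩
  ½ * (S + - S) ≡⟨ solve 1 (λ s → con ½ :* (s :+ (:- s)) := con 0ℚ) refl S ⟩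
  0ℚ            ∎
  where
  open ≡-Reasoning
  S = Σℚ n (λ u → Σℚ n (f u))
  S≡-S : S ≡ - S
  S≡-S = begin
    Σℚ n (λ u → Σℚ n (f u))             ≡⟨ Σ-cong n (λ u → Σ-cong n (anti u)) ⟩
    Σℚ n (λ u → Σℚ n (λ w → - f w u))   ≡⟨ Σ-cong n (λ u → Σ-neg n (λ w → f w u)) ⟩
    Σℚ n (λ u → - Σℚ n (λ w → f w u))   ≡⟨ Σ-neg n (λ u → Σℚ n (λ w → f w u)) ⟩
    - Σℚ n (λ u → Σℚ n (λ w → f w u))   ≡⟨ cong -_ (Σ-swap n n (λ u w → f w u)) ⟩
    - Σℚ n (λ w → Σℚ n (λ u → f w u))   ∎

-- Chosen so that `QVerts (graphArcs G)` unfolds to `sepGenerators G`; the translations for tree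
-- simplices then apply verbatim to the whole polytope.
graphArcs : ∀ {n} → SimpleGraph n → List (Arc n)
graphArcs {n} G = filter (λ e → adj G (proj₁ e) (proj₂ e) Bool.≟ true) (allPairs n)

∈-graphArcs : ∀ {n} (G : SimpleGraph n) {u w} → Adj G u w → (u , w) ∈ graphArcs G
∈-graphArcs {n} G {u} {w} uw = ∈-filter⁺ (λ e → adj G (proj₁ e) (proj₂ e) Bool.≟ true)
  (∈-concatMap⁺ (λ u → map (u ,_) (allFin n)) {xs = allFin n}
    (Any.map (λ { refl → ∈-map⁺ (u ,_) (∈-allFin w) }) (∈-allFin u))) uw

-- By symmetry of adjacency each arc occurs together with its reverse, and the two cancel.
graphArcs-balanced : ∀ {n} (G : SimpleGraph n) i → Σℚ (length (graphArcs G)) (λ j → arcVecs (graphArcs G) j i) ≡ 0ℚ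
graphArcs-balanced {n} G i = trans
  (sumOver-filter (λ e → adj G (proj₁ e) (proj₂ e) Bool.≟ true) (λ e → arcVec e i) (allPairs n))
  (trans (sumOver-allPairs n _) (antisymmetric-sum n f anti))
  where
  f : Fin n → Fin n → ℚ
  f u w = if does (adj G u w Bool.≟ true) then arcVec (u , w) i else 0ℚ
  flip : ∀ b u w → (if does (b Bool.≟ true) then arcVec (u , w) i else 0ℚ)
    ≡ - (if does (b Bool.≟ true) then arcVec (w , u) i else 0ℚ)
  flip true  u w = solve 2 (λ a b → a :- b := :- (b :- a)) refl (δ i w) (δ i u)
  flip false u w = refl
  anti : ∀ u w → f u w ≡ - f w u
  anti u w = trans (cong (λ b → if does (b Bool.≟ true) then arcVec (u , w) i else 0ℚ) (SimpleGraph.sym G u w))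
    (flip (adj G w u) u w)

module _ {n} (G : SimpleGraph n) where
  private
    g : Fin (length (graphArcs G)) → Fin n → ℚ
    g = arcVecs (graphArcs G)

  rep-arc : ∀ {u w} → Adj G u w → ConicRep g (arcVec (u , w)) 1ℚ
  rep-arc uw = subst (λ e → ConicRep g (arcVec e) 1ℚ) (sym (lookup-index (∈-graphArcs G uw)))
    (rep-self (Any.index (∈-graphArcs G uw)))

  rep-path : ∀ {a b} → Star (Adj G) a b → ∃ (ConicRep g (arcVec (a , b)))
  rep-path {a} ε = 0ℚ , rep-cong (λ i → sym (ℚP.+-inverseʳ (δ i a))) refl rep-zero
  rep-path {a} {c} (_◅_ {j = b} ab path) = 1ℚ + proj₁ rest , rep-cong
    (λ i → solve 3 (λ a b c → (b :- a) :+ (c :- b) := c :- a) refl (δ i a) (δ i b) (δ i c)) refl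
    (rep-+ (rep-arc ab) (proj₂ rest))
    where
    rest : ∃ (ConicRep g (arcVec (b , c)))
    rest = rep-path path

  rep-Σ : ∀ k {y : Fin k → Fin n → ℚ} → (∀ u → ∃ (ConicRep g (y u))) → ∃ (ConicRep g (λ i → Σℚ k (λ u → y u i)))
  rep-Σ zero    reps = 0ℚ , rep-zero
  rep-Σ (suc k) reps = proj₁ (reps zero) + proj₁ rest , rep-+ (proj₂ (reps zero)) (proj₂ rest)
    where rest = rep-Σ k (reps ∘ suc)

  -- When the entries of x sum to zero, x is the sum over u of x_u times the unit vector at u minus
  -- that at v. Each term is carried by a path from v to u or from u to v, depending on the sign of
  -- x_u. This is the feasible starting point for the linear program.
  rep-sumZero : Connected G → ∀ x → Fin n → Σℚ n x ≡ 0ℚ → ∃ (ConicRep g x)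
  rep-sumZero conn x v Σx≡0 = proj₁ all , rep-cong eq refl (proj₂ all)
    where
    term : ∀ u → 0ℚ ℚ.≤ x u ⊎ x u ℚ.≤ 0ℚ → ∃ (ConicRep g (λ i → x u * (δ i u - δ i v)))
    term u (inj₁ 0≤x) = _ , rep-* 0≤x (proj₂ (rep-path (conn v u)))
    term u (inj₂ x≤0) = _ , rep-cong
      (λ i → solve 3 (λ x a b → (:- x) :* (b :- a) := x :* (a :- b)) refl (x u) (δ i u) (δ i v)) refl
      (rep-* (0≤neg x≤0) (proj₂ (rep-path (conn u v))))
    all : ∃ (ConicRep g (λ i → Σℚ n (λ u → x u * (δ i u - δ i v))))
    all = rep-Σ n (λ u → term u (ℚP.≤-total 0ℚ (x u)))
    eq : ∀ i → Σℚ n (λ u → x u * (δ i u - δ i v)) ≡ x i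
    eq i = begin
      Σℚ n (λ u → x u * (δ i u - δ i v))
        ≡⟨ Σ-cong n (λ u → solve 3 (λ x a b → x :* (a :- b) := x :* a :- x :* b) refl (x u) (δ i u) (δ i v)) ⟩
      Σℚ n (λ u → x u * δ i u - x u * δ i v)
        ≡⟨ Σ-minus n (λ u → x u * δ i u) (λ u → x u * δ i v) ⟩
      Σℚ n (λ u → x u * δ i u) - Σℚ n (λ u → x u * δ i v)
        ≡⟨ cong₂ _-_ (Σ-δ′ n i x) (trans (Σ-*ʳ n (δ i v) x) (trans (cong (_* δ i v) Σx≡0) (ℚP.*-zeroˡ (δ i v)))) ⟩
      x i - 0ℚ
        ≡⟨ solve 1 (λ x → x :- con 0ℚ := x) refl (x i) ⟩
      x i ∎
      where open ≡-Reasoning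

-- Cones over the simplices of the dissection

recip-inverseˡ : ∀ {x} → 0ℚ ℚ.< x → recip x * x ≡ 1ℚ
recip-inverseˡ {x} 0<x = trans (ℚP.*-comm (recip x) x) (recip-inverse x (<⇒≢′ 0<x))

recip-cancel : ∀ {x} → 0ℚ ℚ.< x → ∀ y → x * (recip x * y) ≡ y
recip-cancel {x} 0<x y = trans (sym (ℚP.*-assoc x (recip x) y))
  (trans (cong (_* y) (recip-inverse x (<⇒≢′ 0<x))) (ℚP.*-identityˡ y))

-- An empty family has total 0, so a positive cost exhibits a generator, as the padding lemmas
-- require.
rep-index : ∀ {m n} {g : Fin m → Fin n → ℚ} {x s} → 0ℚ ℚ.< s → ConicRep g x s → Fin m
rep-index {zero}  0<s r = ⊥-elim (<⇒≢′ 0<s (sym (total r)))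
rep-index {suc m} 0<s r = zero

strictRep-cong : ∀ {m n} {g : Fin m → Fin n → ℚ} {x y s t} → (∀ i → x i ≡ y i) → s ≡ t →
  StrictRep g x s → StrictRep g y t
strictRep-cong x≗y s≡t (r , w>0) = rep-cong x≗y s≡t r , w>0

module Dissection {n : ℕ} (G : SimpleGraph n) (conn : Connected G)
                  (𝒯 : List (List (Arc n))) (diss : IsDissectingTreeSet G 𝒯) where

  g : Fin (length (graphArcs G)) → Fin n → ℚ
  g = arcVecs (graphArcs G)

  open Balanced {g = g} (graphArcs-balanced G)

  basis : ∀ a → Fin (length (lookup 𝒯 a)) → Fin n → ℚ
  basis a = arcVecs (lookup 𝒯 a)

  isTree : ∀ a → SpanningTree (lookup 𝒯 a)
  isTree a = spanningTree (proj₁ (proj₂ (proj₁ diss a))) (proj₂ (proj₂ (proj₁ diss a)))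

  rep-tree : ∀ {a x s} → ConicRep (basis a) x s → ConicRep g x s
  rep-tree {a} = rep-trans λ l → rep-arc G (proj₁ (proj₁ diss a) (lookup (lookup 𝒯 a) l) (∈-lookup l))

  boundary : ∀ {a x} → ConicRep (basis a) x 1ℚ → InRelBoundary (sepGenerators G) (Vec.tabulate x)
  boundary {a} r = Equivalence.from (proj₂ (proj₂ diss) _) (a , rep⇒inConv (lookup 𝒯 a) r)

  -- A representation cheaper than s would put a point of Q_T in the relative interior of P_G.
  gauge : ∀ {a y s t} → ConicRep (basis a) y s → ConicRep g y t → s ℚ.≤ t
  gauge {a} {y} {s} {t} r r′ = ℚP.≮⇒≥ contradiction
    where
    contradiction : ¬ (t ℚ.< s)
    contradiction t<s = proj₂ (boundary rT) (rep⇒inRelInt (graphArcs G) (strictPad (rep-index 0<1 (rep-tree rT)) small rG))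
      where
      0<s : 0ℚ ℚ.< s
      0<s = ℚP.≤-<-trans (rep-total≥0 r′) t<s
      x : Fin n → ℚ
      x i = recip s * y i
      rT : ConicRep (basis a) x 1ℚ
      rT = rep-cong (λ _ → refl) (recip-inverseˡ 0<s) (rep-* (0≤recip 0<s) r)
      rG : ConicRep g x (recip s * t)
      rG = rep-* (0≤recip 0<s) r′
      small : recip s * t ℚ.< 1ℚ
      small = <-by (recip s * (s - t)) (0<* (0<recip 0<s) (<⇒0<- t<s))
        (trans (solve 3 (λ r s t → r :* t :+ r :* (s :- t) := r :* s) refl (recip s) s t) (recip-inverseˡ 0<s))

  some-tree : ∀ y → Σℚ n y ≡ 0ℚ → ∀ u → y u ≢ 0ℚ → ∃ λ a → ∃ λ s → ConicRep (basis a) y s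
  some-tree y Σy≡0 u yu≢0 = proj₁ covered , s * 1ℚ
    , rep-cong unscale refl (rep-* (ℚP.<⇒≤ 0<s) (inConv⇒rep (lookup 𝒯 (proj₁ covered)) (proj₂ covered)))
    where
    cheapest : ∃ (Minimal (ConicRep g y))
    cheapest = cheapest-rep g y (proj₂ (rep-sumZero G conn y u Σy≡0))
    s : ℚ
    s = proj₁ cheapest
    r : ConicRep g y s
    r = proj₁ (proj₂ cheapest)
    0<s : 0ℚ ℚ.< s
    0<s = by-sign (ℚP.<-cmp 0ℚ s)
      where
      by-sign : Tri (0ℚ ℚ.< s) (0ℚ ≡ s) (s ℚ.< 0ℚ) → 0ℚ ℚ.< s
      by-sign (tri< 0<s _ _) = 0<s
      -- At cost 0 all weights vanish, contrary to the non-zero entry of `y` at `u`.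
      by-sign (tri≈ _ 0≡s _) = ⊥-elim (yu≢0 (rep-total0 (subst (ConicRep g y) (sym 0≡s) r) u))
      by-sign (tri> _ _ s<0) = ⊥-elim (ℚP.<-irrefl {0ℚ} refl (ℚP.≤-<-trans (rep-total≥0 r) s<0))
    x : Fin n → ℚ
    x i = recip s * y i
    unscale : ∀ i → s * Vec.lookup (Vec.tabulate x) i ≡ y i
    unscale i = trans (cong (s *_) (VecP.lookup∘tabulate x i)) (recip-cancel 0<s (y i))
    rx : ConicRep g x 1ℚ
    rx = rep-cong (λ _ → refl) (recip-inverseˡ 0<s) (rep-* (0≤recip 0<s) r)
    not-interior : ¬ InRelInt (sepGenerators G) (Vec.tabulate x)
    -- A representation of `x` cheaper than 1, scaled back by `s`, would undercut the minimal cost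
    -- of `y`.
    not-interior int = ℚP.<-irrefl {s} refl (ℚP.≤-<-trans
      (proj₂ (proj₂ cheapest) (s * proj₁ cheap) (rep-cong unscale refl (rep-* (ℚP.<⇒≤ 0<s) (proj₂ (proj₂ cheap)))))
      (<-by (s * (1ℚ - proj₁ cheap)) (0<* 0<s (<⇒0<- (proj₁ (proj₂ cheap))))
        (solve 2 (λ s t → s :* t :+ s :* (con 1ℚ :- t) := s) refl s (proj₁ cheap))))
      where
      cheap : ∃ λ t → t ℚ.< 1ℚ × ConicRep g (Vec.lookup (Vec.tabulate x)) t
      cheap = cheaper (rep-index 0<1 rx) (inRelInt⇒rep (graphArcs G) int)
    covered : ∃ λ a → InConv (QVerts (lookup 𝒯 a)) (Vec.tabulate x)
    covered = Equivalence.to (proj₂ (proj₂ diss) _) (rep⇒inConv (graphArcs G) rx , not-interior)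

  -- `gauge` applied in both directions makes the two costs equal, so one scaling factor brings `y`
  -- into the relative interiors of both simplices.
  cones-disjoint : ∀ {a b y s t} → a ≢ b → 0ℚ ℚ.< s → StrictRep (basis a) y s → ¬ StrictRep (basis b) y t
  cones-disjoint {a} {b} {y} {s} {t} a≢b 0<s ra rb = proj₁ (proj₂ diss) a b a≢b (Vec.tabulate (λ i → recip s * y i))
    ( rep⇒inRelInt (lookup 𝒯 a) (strictRep-cong (λ _ → refl) (recip-inverseˡ 0<s) (strictRep-* (0<recip 0<s) ra))
    , rep⇒inRelInt (lookup 𝒯 b) (strictRep-cong (λ _ → refl)
        (trans (cong (recip s *_) t≡s) (recip-inverseˡ 0<s)) (strictRep-* (0<recip 0<s) rb)))
    where
    t≡s : t ≡ s
    t≡s = ℚP.≤-antisym (gauge (proj₁ rb) (rep-tree (proj₁ ra))) (gauge (proj₁ ra) (rep-tree (proj₁ rb)))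

-- N c + (N χ − S) is the coordinate of N z + q on an edge whose head component has S vertices,
-- where χ ∈ {0, 1} tells whether v is among them and c is the coordinate of z.
closed-positive : ∀ {N S c} → 0ℚ ℚ.< S → S ℚ.< N → 0ℚ ℚ.≤ c → 0ℚ ℚ.< N * c + (N * 1ℚ - S)
closed-positive {N} {S} {c} 0<S S<N 0≤c = ℚP.+-mono-≤-< (0≤* (ℚP.<⇒≤ (ℚP.<-trans 0<S S<N)) 0≤c)
  (subst (λ a → 0ℚ ℚ.< a - S) (sym (ℚP.*-identityʳ N)) (<⇒0<- S<N))

open-positive : ∀ {N S c} → 0ℚ ℚ.< S → S ℚ.< N → 1ℚ ℚ.≤ c → 0ℚ ℚ.< N * c + (N * 0ℚ - S)
open-positive {N} {S} {c} 0<S S<N 1≤c = subst (0ℚ ℚ.<_)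
  (solve 3 (λ N S c → N :* (c :- con 1ℚ) :+ (N :- S) := N :* c :+ (N :* con 0ℚ :- S)) refl N S c)
  (ℚP.+-mono-≤-< (0≤* (ℚP.<⇒≤ (ℚP.<-trans 0<S S<N)) (≤⇒0≤- 1≤c)) (<⇒0<- S<N))

absurd-< : {A : Set} {x : ℚ} → 0ℚ ℚ.≤ x → 0ℚ ℚ.< - x → A
absurd-< {x = x} 0≤x 0<-x = ⊥-elim (ℚP.<-irrefl refl
  (subst (0ℚ ℚ.<_) (ℚP.+-inverseʳ x) (ℚP.+-mono-≤-< 0≤x 0<-x)))

-- Integrality turns failure into a full unit: c ≤ -1 would make the expression at most -S, which is
-- negative. In `open-nonneg` the same happens as soon as c ≤ 0.
closed-nonneg : ∀ {N S c} → 0ℚ ℚ.< S → S ℚ.< N → IsInt c → 0ℚ ℚ.≤ N * c + (N * 1ℚ - S) → 0ℚ ℚ.≤ c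
closed-nonneg {N} {S} {c} 0<S S<N int 0≤e = cases (isInt-≤0⊎1≤ (isInt-neg int))
  where
  cases : - c ℚ.≤ 0ℚ ⊎ 1ℚ ℚ.≤ - c → 0ℚ ℚ.≤ c
  cases (inj₁ -c≤0) = subst (0ℚ ℚ.≤_) (solve 1 (λ c → :- (:- c) := c) refl c) (0≤neg -c≤0)
  cases (inj₂ 1≤-c) = absurd-< 0≤e (subst (0ℚ ℚ.<_)
    (solve 3 (λ N S c → N :* ((:- c) :- con 1ℚ) :+ S := :- (N :* c :+ (N :* con 1ℚ :- S))) refl N S c)
    (ℚP.+-mono-≤-< (0≤* (ℚP.<⇒≤ (ℚP.<-trans 0<S S<N)) (≤⇒0≤- 1≤-c)) 0<S))

open-nonneg : ∀ {N S c} → 0ℚ ℚ.< S → S ℚ.< N → IsInt c → 0ℚ ℚ.≤ N * c + (N * 0ℚ - S) → 1ℚ ℚ.≤ c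
open-nonneg {N} {S} {c} 0<S S<N int 0≤e = cases (isInt-≤0⊎1≤ int)
  where
  cases : c ℚ.≤ 0ℚ ⊎ 1ℚ ℚ.≤ c → 1ℚ ℚ.≤ c
  cases (inj₂ 1≤c) = 1≤c
  cases (inj₁ c≤0) = absurd-< 0≤e (subst (0ℚ ℚ.<_)
    (solve 3 (λ N S c → N :* (:- c) :+ S := :- (N :* c :+ (N :* con 0ℚ :- S))) refl N S c)
    (ℚP.+-mono-≤-< (0≤* (ℚP.<⇒≤ (ℚP.<-trans 0<S S<N)) (0≤neg c≤0)) 0<S))

-- Half-open cells of lattice points in the sum-zero hyperplane

arcVec-sum : ∀ {n} (e : Arc n) → Σℚ n (arcVec e) ≡ 0ℚ
arcVec-sum {n} (t , h) = trans (Σ-minus n (λ i → δ i h) (λ i → δ i t))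
  (trans (cong₂ _-_ (one h) (one t)) (ℚP.+-inverseʳ 1ℚ))
  where
  one : ∀ u → Σℚ n (λ i → δ i u) ≡ 1ℚ
  one u = trans (Σ-cong n (λ i → sym (ℚP.*-identityˡ (δ i u)))) (Σ-δ n u (λ _ → 1ℚ))

comb-sum : ∀ {n} (es : List (Arc n)) (c : Fin (length es) → ℚ) → Σℚ n (comb c (arcVecs es)) ≡ 0ℚ
comb-sum {n} es c = begin
  Σℚ n (λ i → Σℚ m (λ j → c j * arcVecs es j i))   ≡⟨ Σ-swap n m (λ i j → c j * arcVecs es j i) ⟩
  Σℚ m (λ j → Σℚ n (λ i → c j * arcVecs es j i))   ≡⟨ Σ-cong m (λ j → trans (Σ-*ˡ n (c j) (arcVecs es j))
                                                        (trans (cong (c j *_) (arcVec-sum (lookup es j))) (ℚP.*-zeroʳ (c j)))) ⟩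
  Σℚ m (λ _ → 0ℚ)                                  ≡⟨ Σ-zero m ⟩
  0ℚ                                               ∎
  where
  open ≡-Reasoning
  m = length es

rep-sum : ∀ {n} {es : List (Arc n)} {x s} → ConicRep (arcVecs es) x s → Σℚ n x ≡ 0ℚ
rep-sum {n} {es} (conicRep c _ _ eq) = trans (Σ-cong n eq) (comb-sum es c)

first : ∀ {n} → 2 ≤ n → Fin (n ℕ.∸ 1)
first (s≤s (s≤s _)) = zero

another : ∀ {n} → 2 ≤ n → (v : Fin n) → ∃ λ u → u ≢ v
another (s≤s (s≤s _)) zero    = suc zero , λ ()
another (s≤s (s≤s _)) (suc v) = zero , λ ()

1<size : ∀ {n} → 2 ≤ n → 1ℚ ℚ.< Σℚ n (λ _ → 1ℚ)
1<size {suc (suc n)} (s≤s (s≤s _)) = <-by (Σℚ (suc n) (λ _ → 1ℚ))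
  (0<Σ (suc n) (λ _ → 0≤1) zero 0<1) refl

lattice : ∀ {n} → Vec ℤ n → Fin n → ℚ
lattice z u = ℤ→ℚ (Vec.lookup z u)

lattice-injective : ∀ {n} {z w : Vec ℤ n} → (∀ u → lattice z u ≡ lattice w u) → z ≡ w
lattice-injective {z = z} {w} eq = trans (sym (VecP.tabulate∘lookup z))
  (trans (VecP.tabulate-cong (λ u → ℤ→ℚ-injective (eq u))) (VecP.tabulate∘lookup w))

module Cells {n : ℕ} (2≤n : 2 ≤ n) (G : SimpleGraph n) (conn : Connected G)
             (𝒯 : List (List (Arc n))) (diss : IsDissectingTreeSet G 𝒯) (v : Fin n) where

  open Dissection G conn 𝒯 diss
  open Balanced {g = g} (graphArcs-balanced G) using (pad)

  dim : Fin (length 𝒯) → ℕ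
  dim a = length (lookup 𝒯 a)

  dim≡ : ∀ a → dim a ≡ n ℕ.∸ 1
  dim≡ a = SpanningTree.size (isTree a)

  someArc : ∀ a → Fin (dim a)
  someArc a = subst Fin (sym (dim≡ a)) (first 2≤n)

  coord : ∀ a → Fin (dim a) → (Fin n → ℚ) → ℚ
  coord a = TreeBasis.coord (isTree a)

  χ : ∀ a → Fin (dim a) → Fin n → ℚ
  χ a = TreeBasis.χ (isTree a)

  away : ∀ a → Fin (dim a) → Bool
  away a j = not (TreeBasis.side (isTree a) j v)

  coord-spans : ∀ a x → Σℚ n x ≡ 0ℚ → ∀ i → x i ≡ comb (λ j → coord a j x) (basis a) i
  coord-spans a = TreeBasis.basis-spans (isTree a)

  coord-rep : ∀ a {x s} (r : ConicRep (basis a) x s) j → coord a j x ≡ weight r j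
  coord-rep a r j = trans (TreeBasis.coord-cong (isTree a) j (sums r)) (TreeBasis.coord-comb (isTree a) j (weight r))

  N : ℚ
  N = Σℚ n (λ _ → 1ℚ)

  q : Fin n → ℚ
  q u = N * δ u v - 1ℚ

  -- The infinitesimal push made finite: this is N times z + q/N. Tree coordinates of q/N are
  -- non-zero and lie strictly between -1 and 1, so for integral z they act as an infinitesimal
  -- would, deciding the sign only where z has coordinate 0.
  perturb : (Fin n → ℚ) → Fin n → ℚ
  perturb z u = N * z u + q u

  q-sum : Σℚ n q ≡ 0ℚ
  q-sum = trans (Σ-minus n (λ u → N * δ u v) (λ _ → 1ℚ))
    (trans (cong (_- N) (Σ-δ n v (λ _ → N))) (ℚP.+-inverseʳ N))

  perturb-sum : ∀ z → Σℚ n z ≡ 0ℚ → Σℚ n (perturb z) ≡ 0ℚ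
  perturb-sum z Σz≡0 = begin
    Σℚ n (perturb z)                       ≡⟨ Σ-+ n (λ u → N * z u) q ⟩
    Σℚ n (λ u → N * z u) + Σℚ n q          ≡⟨ cong₂ _+_ (Σ-*ˡ n N z) q-sum ⟩
    N * Σℚ n z + 0ℚ                        ≡⟨ cong (λ a → N * a + 0ℚ) Σz≡0 ⟩
    N * 0ℚ + 0ℚ                            ≡⟨ solve 1 (λ N → N :* con 0ℚ :+ con 0ℚ := con 0ℚ) refl N ⟩
    0ℚ                                     ∎
    where open ≡-Reasoning

  -- Away from `v` the entry is N z_u - 1, which cannot vanish for integral z_u because N ≥ 2. This
  -- is the non-zero entry that `some-tree` asks for.
  perturb-nonzero : ∀ z → (∀ u → IsInt (z u)) → ∀ u → u ≢ v → perturb z u ≢ 0ℚ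
  perturb-nonzero z int u u≢v eq = cases (isInt-≤0⊎1≤ (int u))
    where
    -- Rewritten to the form N c + (N 0 - S) with S = 1, so that the sign lemmas for coordinates
    -- apply to an entry as well.
    eq′ : N * z u + (N * 0ℚ - 1ℚ) ≡ 0ℚ
    eq′ = trans (cong (λ a → N * z u + (N * a - 1ℚ)) (sym (δ-off u≢v))) eq
    cases : z u ℚ.≤ 0ℚ ⊎ 1ℚ ℚ.≤ z u → ⊥
    cases (inj₁ z≤0) = ℚP.<-irrefl refl (ℚP.<-≤-trans 0<1
      (ℚP.≤-trans (open-nonneg 0<1 (1<size 2≤n) (int u) (ℚP.≤-reflexive (sym eq′))) z≤0))
    cases (inj₂ 1≤z) = <⇒≢′ (open-positive 0<1 (1<size 2≤n) 1≤z) eq′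

  module _ (a : Fin (length 𝒯)) (j : Fin (dim a)) where
    open FundamentalCut (isTree a) j using (side; side-head; side-tail; head; tail)

    S : ℚ
    S = Σℚ n (χ a j)

    0≤indicator : ∀ b → 0ℚ ℚ.≤ (if b then 1ℚ else 0ℚ)
    0≤indicator true  = 0≤1
    0≤indicator false = ℚP.≤-refl

    0≤1-indicator : ∀ b → 0ℚ ℚ.≤ 1ℚ - (if b then 1ℚ else 0ℚ)
    0≤1-indicator true  = ℚP.≤-refl
    0≤1-indicator false = 0≤1

    0<S : 0ℚ ℚ.< S
    0<S = 0<Σ n (λ u → 0≤indicator (side u)) head
      (subst (λ b → 0ℚ ℚ.< (if b then 1ℚ else 0ℚ)) (sym side-head) 0<1)

    S<N : S ℚ.< N
    S<N = <-by (Σℚ n (λ u → 1ℚ - χ a j u))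
      (0<Σ n (λ u → 0≤1-indicator (side u)) tail
        (subst (λ b → 0ℚ ℚ.< 1ℚ - (if b then 1ℚ else 0ℚ)) (sym side-tail) 0<1))
      (trans (cong (S +_) (Σ-minus n (λ _ → 1ℚ) (χ a j))) (solve 2 (λ S N → S :+ (N :- S) := N) refl S N))

    coord-q : coord a j q ≡ N * χ a j v - S
    coord-q = begin
      Σℚ n (λ u → (N * δ u v - 1ℚ) * χ a j u)
        ≡⟨ Σ-cong n (λ u → solve 3 (λ N d c → (N :* d :- con 1ℚ) :* c := N :* (c :* d) :- c) refl N (δ u v) (χ a j u)) ⟩
      Σℚ n (λ u → N * (χ a j u * δ u v) - χ a j u)
        ≡⟨ Σ-minus n (λ u → N * (χ a j u * δ u v)) (χ a j) ⟩
      Σℚ n (λ u → N * (χ a j u * δ u v)) - S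
        ≡⟨ cong (_- S) (trans (Σ-*ˡ n N (λ u → χ a j u * δ u v)) (cong (N *_) (Σ-δ n v (χ a j)))) ⟩
      N * χ a j v - S ∎
      where open ≡-Reasoning

    coord-perturb : ∀ z → coord a j (perturb z) ≡ N * coord a j z + (N * χ a j v - S)
    coord-perturb z = trans (TreeBasis.coord-+ (isTree a) j (λ u → N * z u) q)
      (cong₂ _+_ (TreeBasis.coord-* (isTree a) j N z) coord-q)

  InCell : Fin (length 𝒯) → (Fin n → ℚ) → Set
  InCell a z = ∀ j → 0ℚ ℚ.≤ coord a j z × (away a j ≡ true → 1ℚ ℚ.≤ coord a j z)

  inCell⇒positive : ∀ a z → InCell a z → ∀ j → 0ℚ ℚ.< coord a j (perturb z)
  inCell⇒positive a z cell j = subst (0ℚ ℚ.<_) (sym (coord-perturb a j z))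
    (by-side (TreeBasis.side (isTree a) j v) (proj₁ (cell j)) (proj₂ (cell j)))
    where
    by-side : ∀ b → 0ℚ ℚ.≤ coord a j z → (not b ≡ true → 1ℚ ℚ.≤ coord a j z) →
      0ℚ ℚ.< N * coord a j z + (N * (if b then 1ℚ else 0ℚ) - S a j)
    by-side true  0≤c _   = closed-positive (0<S a j) (S<N a j) 0≤c
    by-side false _   1≤c = open-positive (0<S a j) (S<N a j) (1≤c refl)

  -- Covering by the dissection yields only closed cones. Closed membership is enough, since a
  -- perturbed lattice point has no zero coordinate and so lies on no facet.
  nonneg⇒inCell : ∀ a z → (∀ u → IsInt (z u)) → (∀ j → 0ℚ ℚ.≤ coord a j (perturb z)) → InCell a z
  nonneg⇒inCell a z int 0≤y j = by-side (TreeBasis.side (isTree a) j v)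
    (subst (0ℚ ℚ.≤_) (coord-perturb a j z) (0≤y j))
    where
    int-c : IsInt (coord a j z)
    int-c = TreeBasis.isInt-coord (isTree a) j int
    by-side : ∀ b → 0ℚ ℚ.≤ N * coord a j z + (N * (if b then 1ℚ else 0ℚ) - S a j) →
      0ℚ ℚ.≤ coord a j z × (not b ≡ true → 1ℚ ℚ.≤ coord a j z)
    by-side true  0≤e = closed-nonneg (0<S a j) (S<N a j) int-c 0≤e , λ ()
    by-side false 0≤e = ℚP.≤-trans 0≤1 1≤c , λ _ → 1≤c
      where
      1≤c : 1ℚ ℚ.≤ coord a j z
      1≤c = open-nonneg (0<S a j) (S<N a j) int-c 0≤e

  some-cell : ∀ z → (∀ u → IsInt (z u)) → Σℚ n z ≡ 0ℚ → ∃ λ a → InCell a z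
  some-cell z int Σz≡0 = a , nonneg⇒inCell a z int
    λ j → subst (0ℚ ℚ.≤_) (sym (coord-rep a r j)) (weight≥0 r j)
    where
    other : ∃ λ u → u ≢ v
    other = another 2≤n v
    covering : ∃ λ a → ∃ λ s → ConicRep (basis a) (perturb z) s
    covering = some-tree (perturb z) (perturb-sum z Σz≡0) (proj₁ other)
      (perturb-nonzero z int (proj₁ other) (proj₂ other))
    a = proj₁ covering
    r : ConicRep (basis a) (perturb z) (proj₁ (proj₂ covering))
    r = proj₂ (proj₂ covering)

  cell-unique : ∀ a b z → Σℚ n z ≡ 0ℚ → InCell a z → InCell b z → a ≡ b
  cell-unique a b z Σz≡0 cell-a cell-b = decide (a Fin.≟ b)
    where
    strict : ∀ a → InCell a z → StrictRep (basis a) (perturb z) (Σℚ (dim a) (λ j → coord a j (perturb z)))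
    strict a cell = conicRep _ (λ j → ℚP.<⇒≤ (inCell⇒positive a z cell j)) refl
      (coord-spans a (perturb z) (perturb-sum z Σz≡0)) , inCell⇒positive a z cell
    decide : Dec (a ≡ b) → a ≡ b
    decide (yes a≡b) = a≡b
    -- `someArc` is there to make the total cost positive, as scaling to cost 1 requires.
    decide (no a≢b)  = ⊥-elim (cones-disjoint a≢b
      (0<Σ (dim a) (λ j → ℚP.<⇒≤ (inCell⇒positive a z cell-a j)) (someArc a) (inCell⇒positive a z cell-a (someArc a)))
      (strict a cell-a) (strict b cell-b))

  weights : ∀ {m} → Vec ℕ m → Fin m → ℚ
  weights x j = ℕ→ℚ (Vec.lookup x j)

  isInt-point : ∀ a (x : Vec ℕ (dim a)) i → IsInt (comb (weights x) (basis a) i)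
  isInt-point a x i = isInt-Σ (dim a) λ j → isInt-* (ℤ.+ Vec.lookup x j , refl)
    (isInt-+ (isInt-δ i _) (isInt-neg (isInt-δ i _)))

  point : ∀ a → Vec ℕ (dim a) → Vec ℤ n
  point a x = Vec.tabulate (λ i → proj₁ (isInt-point a x i))

  lattice-point : ∀ a x i → lattice (point a x) i ≡ comb (weights x) (basis a) i
  lattice-point a x i = trans (cong ℤ→ℚ (VecP.lookup∘tabulate _ i)) (sym (proj₂ (isInt-point a x i)))

  point-rep : ∀ a x → ConicRep (basis a) (lattice (point a x)) (ℕ→ℚ (Vec.sum x))
  point-rep a x = conicRep (weights x) (λ j → ℕ→ℚ-mono 0 (Vec.lookup x j) z≤n) (sym (ℕ→ℚ-sum x)) (lattice-point a x)

  coord-point : ∀ a x j → coord a j (lattice (point a x)) ≡ weights x j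
  coord-point a x j = coord-rep a (point-rep a x) j

  point-injective : ∀ a {x y} → point a x ≡ point a y → x ≡ y
  point-injective a {x} {y} eq = trans (sym (VecP.tabulate∘lookup x))
    (trans (VecP.tabulate-cong λ j → ℕ→ℚ-injective (trans (sym (coord-point a x j))
      (trans (cong (λ z → coord a j (lattice z)) eq) (coord-point a y j))))
    (VecP.tabulate∘lookup y))

  -- An image of natural coordinate vectors, so that the count of `HalfOpen` transfers along the
  -- injective `point`. The dilation factor enters only through the bound on the coordinate sum.
  Cell : ℕ → Fin (length 𝒯) → Vec ℤ n → Set
  Cell t a z = ∃ λ x → HalfOpen (dim a) (away a) t x × z ≡ point a x

  cell⇒inCell : ∀ {t a z} → Cell t a z → InCell a (lattice z)
  cell⇒inCell {a = a} (x , (marked , _) , refl) j =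
      subst (0ℚ ℚ.≤_) (sym (coord-point a x j)) (ℕ→ℚ-mono 0 (Vec.lookup x j) z≤n)
    , λ m → subst (1ℚ ℚ.≤_) (sym (coord-point a x j)) (ℕ→ℚ-mono 1 (Vec.lookup x j) (marked j m))

  cells-disjoint : ∀ t a b → a ≢ b → ∀ z → Cell t a z → ¬ Cell t b z
  cells-disjoint t a b a≢b z ca@(x , _ , refl) cb = a≢b (cell-unique a b (lattice z)
    (rep-sum {es = lookup 𝒯 a} (point-rep a x)) (cell⇒inCell ca) (cell⇒inCell cb))

  dilate⇒rep : ∀ {t z} → InDilateLattice (InSEP G) t z → ConicRep g (lattice z) (ℕ→ℚ t)
  dilate⇒rep {t} {z} (x , inP , eq) = rep-cong
    (λ i → trans (sym (VecP.lookup-map i (ℕ→ℚ t *_) x))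
      (trans (cong (λ y → Vec.lookup y i) eq) (VecP.lookup-map i ℤ→ℚ z)))
    (ℚP.*-identityʳ (ℕ→ℚ t))
    (rep-* {a = ℕ→ℚ t} (ℕ→ℚ-mono 0 t z≤n) (inConv⇒rep (graphArcs G) inP))

  dilate⇒cell : ∀ {t z} → InDilateLattice (InSEP G) t z → ∃ λ a → Cell t a z
  -- By `gauge` no representation over the graph is cheaper than the one over the tree, so its cost,
  -- the sum of `x`, is at most `t`.
  dilate⇒cell {t} {z} dil = a , x , (marked , ℕ→ℚ-cancel (Vec.sum x) t (subst (ℚ._≤ ℕ→ℚ t) total-x (gauge r r′)))
    , lattice-injective (λ u → trans (coord-spans a (lattice z) Σz≡0 u)
        (trans (Σ-cong (dim a) (λ j → cong (_* basis a j u) (coord≡ j))) (sym (lattice-point a x u))))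
    where
    r′ : ConicRep g (lattice z) (ℕ→ℚ t)
    r′ = dilate⇒rep {t} {z} dil
    Σz≡0 : Σℚ n (lattice z) ≡ 0ℚ
    Σz≡0 = rep-sum {es = graphArcs G} r′
    int : ∀ u → IsInt (lattice z u)
    int u = Vec.lookup z u , refl
    found : ∃ λ a → InCell a (lattice z)
    found = some-cell (lattice z) int Σz≡0
    a = proj₁ found
    cell : InCell a (lattice z)
    cell = proj₂ found
    natural : ∀ j → ∃ λ k → coord a j (lattice z) ≡ ℕ→ℚ k
    natural j = isInt-nonNeg (TreeBasis.isInt-coord (isTree a) j int) (proj₁ (cell j))
    x : Vec ℕ (dim a)
    x = Vec.tabulate (λ j → proj₁ (natural j))
    coord≡ : ∀ j → coord a j (lattice z) ≡ weights x j
    coord≡ j = trans (proj₂ (natural j)) (cong ℕ→ℚ (sym (VecP.lookup∘tabulate _ j)))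
    marked : ∀ j → away a j ≡ true → 1 ≤ Vec.lookup x j
    marked j m = ℕ→ℚ-cancel 1 (Vec.lookup x j) (subst (1ℚ ℚ.≤_) (coord≡ j) (proj₂ (cell j) m))
    r : ConicRep (basis a) (lattice z) (Σℚ (dim a) (λ j → coord a j (lattice z)))
    r = conicRep _ (λ j → proj₁ (cell j)) refl (coord-spans a (lattice z) Σz≡0)
    total-x : Σℚ (dim a) (λ j → coord a j (lattice z)) ≡ ℕ→ℚ (Vec.sum x)
    total-x = trans (Σ-cong (dim a) coord≡) (sym (ℕ→ℚ-sum x))

  cell⇒dilate : ∀ {t z} → (∃ λ a → Cell t a z) → InDilateLattice (InSEP G) t z
  cell⇒dilate {t} {z} (a , x , (_ , sum≤t) , refl) = Vec.tabulate y , rep⇒inConv (graphArcs G) y-rep , (begin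
    Vec.map (ℕ→ℚ t *_) (Vec.tabulate y)   ≡⟨ VecP.tabulate-∘ (ℕ→ℚ t *_) y ⟨
    Vec.tabulate (λ i → ℕ→ℚ t * y i)      ≡⟨ VecP.tabulate-cong (unscale t r) ⟩
    Vec.tabulate (lattice z)              ≡⟨ VecP.tabulate-∘ ℤ→ℚ (Vec.lookup z) ⟩
    Vec.map ℤ→ℚ (Vec.tabulate (Vec.lookup z)) ≡⟨ cong (Vec.map ℤ→ℚ) (VecP.tabulate∘lookup z) ⟩
    Vec.map ℤ→ℚ z                         ∎)
    where
    open ≡-Reasoning
    k : Fin (length (graphArcs G))
    k = rep-index 0<1 (rep-tree {a} (rep-self (someArc a)))
    r : ConicRep g (lattice z) (ℕ→ℚ t)
    r = pad k (ℕ→ℚ-mono (Vec.sum x) t sum≤t) (rep-tree (point-rep a x))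
    -- For t = 0 this is the origin, and `z` is zero too because its representation has cost 0.
    y : Fin n → ℚ
    y i = recip (ℕ→ℚ t) * lattice z i
    0<ℕ→ℚ : ∀ t → 0ℚ ℚ.< ℕ→ℚ (suc t)
    0<ℕ→ℚ t = ℚP.<-≤-trans 0<1 (ℕ→ℚ-mono 1 (suc t) (s≤s z≤n))
    unscale : ∀ t → ConicRep g (lattice z) (ℕ→ℚ t) → ∀ i → ℕ→ℚ t * (recip (ℕ→ℚ t) * lattice z i) ≡ lattice z i
    unscale zero    r i = trans (ℚP.*-zeroˡ (recip 0ℚ * lattice z i)) (sym (rep-total0 r i))
    unscale (suc t) r i = recip-cancel (0<ℕ→ℚ t) (lattice z i)
    0≤recip′ : ∀ t → 0ℚ ℚ.≤ recip (ℕ→ℚ t)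
    0≤recip′ zero    = ℚP.≤-refl
    0≤recip′ (suc t) = 0≤recip (0<ℕ→ℚ t)
    recip*≤1 : ∀ t → recip (ℕ→ℚ t) * ℕ→ℚ t ℚ.≤ 1ℚ
    recip*≤1 zero    = 0≤1
    recip*≤1 (suc t) = ℚP.≤-reflexive (recip-inverseˡ (0<ℕ→ℚ t))
    y-rep : ConicRep g y 1ℚ
    -- The scaled cost is 1 for positive t but 0 for t = 0; padding covers both.
    y-rep = pad k (recip*≤1 t) (rep-* (0≤recip′ t) r)

  awayEdges : Fin (length 𝒯) → ℕ
  awayEdges a = count (dim a) (away a)

  hasCount-dilate : ∀ t → HasCount (InDilateLattice (InSEP G) t)
    (Σℕ (length 𝒯) (λ a → (t ℕ.+ (dim a ℕ.∸ awayEdges a)) C dim a))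
  hasCount-dilate t = hasCount-cong (cell⇒dilate {t}) (dilate⇒cell {t})
    (hasCount-⋃ (length 𝒯) (cells-disjoint t)
      (λ a → hasCount-image (point a) (point-injective a) (hasCount-halfOpen (dim a) (away a) t)))

-- Dimension

Σ-punchIn : ∀ m (p : Fin (suc m)) (f : Fin (suc m) → ℚ) → Σℚ (suc m) f ≡ f p + Σℚ m (f ∘ punchIn p)
Σ-punchIn m       zero    f = refl
Σ-punchIn (suc m) (suc p) f = trans (cong (f zero +_) (Σ-punchIn m p (f ∘ suc)))
  (solve 3 (λ a b c → a :+ (b :+ c) := b :+ (a :+ c)) refl
    (f zero) (f (suc p)) (Σℚ m (f ∘ suc ∘ punchIn p)))

Dependence : ∀ {m k} → (Fin m → Fin k → ℚ) → Set
Dependence f = ∃ λ c → (∃ λ i → c i ≢ 0ℚ) × (∀ l → comb c f l ≡ 0ℚ)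

-- One step of Gaussian elimination: multiples of the vector at `p` clear the first entry of the
-- others, and a dependence among the shortened vectors lifts back.
module Pivot {k} (f : Fin (suc (suc k)) → Fin (suc k) → ℚ) (p : Fin (suc (suc k))) (pivot≢0 : f p zero ≢ 0ℚ) where

  ratio : Fin (suc k) → ℚ
  ratio i = f (punchIn p i) zero * recip (f p zero)

  reduced : Fin (suc k) → Fin k → ℚ
  reduced i l = f (punchIn p i) (suc l) - ratio i * f p (suc l)

  module _ (c′ : Fin (suc k) → ℚ) where

    -- The coefficient of the pivot vector that makes up for the multiples subtracted from the
    -- others.
    head : ℚ
    head = - Σℚ (suc k) (λ i → c′ i * ratio i)

    c : Fin (suc (suc k)) → ℚ
    c = insertAt c′ p head

    comb-c : ∀ l → comb c f l ≡ Σℚ (suc k) (λ i → c′ i * (f (punchIn p i) l - ratio i * f p l))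
    comb-c l = begin
      Σℚ (suc (suc k)) (λ i → c i * f i l)
        ≡⟨ Σ-punchIn (suc k) p (λ i → c i * f i l) ⟩
      c p * f p l + Σℚ (suc k) (λ i → c (punchIn p i) * f (punchIn p i) l)
        ≡⟨ cong₂ _+_ (cong (_* f p l) (insertAt-lookup c′ p head))
             (Σ-cong (suc k) (λ i → cong (_* f (punchIn p i) l) (insertAt-punchIn c′ p head i))) ⟩
      - Σℚ (suc k) (λ i → c′ i * ratio i) * f p l + Σℚ (suc k) (λ i → c′ i * f (punchIn p i) l)
        ≡⟨ solve 3 (λ s x y → (:- s) :* x :+ y := y :- s :* x) refl
             (Σℚ (suc k) (λ i → c′ i * ratio i)) (f p l) (Σℚ (suc k) (λ i → c′ i * f (punchIn p i) l)) ⟩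
      Σℚ (suc k) (λ i → c′ i * f (punchIn p i) l) - Σℚ (suc k) (λ i → c′ i * ratio i) * f p l
        ≡⟨ cong (λ s → Σℚ (suc k) (λ i → c′ i * f (punchIn p i) l) - s) (Σ-*ʳ (suc k) (f p l) (λ i → c′ i * ratio i)) ⟨
      Σℚ (suc k) (λ i → c′ i * f (punchIn p i) l) - Σℚ (suc k) (λ i → c′ i * ratio i * f p l)
        ≡⟨ Σ-minus (suc k) (λ i → c′ i * f (punchIn p i) l) (λ i → c′ i * ratio i * f p l) ⟨
      Σℚ (suc k) (λ i → c′ i * f (punchIn p i) l - c′ i * ratio i * f p l)
        ≡⟨ Σ-cong (suc k) (λ i → solve 4 (λ c x r y → c :* x :- c :* r :* y := c :* (x :- r :* y)) refl
             (c′ i) (f (punchIn p i) l) (ratio i) (f p l)) ⟩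
      Σℚ (suc k) (λ i → c′ i * (f (punchIn p i) l - ratio i * f p l)) ∎
      where open ≡-Reasoning

    ratio-exact : ∀ i → f (punchIn p i) zero - ratio i * f p zero ≡ 0ℚ
    ratio-exact i = begin
      x - x * r * y       ≡⟨ solve 3 (λ x r y → x :- x :* r :* y := x :- x :* (y :* r)) refl x r y ⟩
      x - x * (y * r)     ≡⟨ cong (λ a → x - x * a) (recip-inverse y pivot≢0) ⟩
      x - x * 1ℚ          ≡⟨ solve 1 (λ x → x :- x :* con 1ℚ := con 0ℚ) refl x ⟩
      0ℚ                  ∎
      where
      open ≡-Reasoning
      x = f (punchIn p i) zero
      y = f p zero
      r = recip y

    comb-zero : comb c f zero ≡ 0ℚ
    comb-zero = trans (comb-c zero) (trans
      (Σ-cong (suc k) (λ i → trans (cong (c′ i *_) (ratio-exact i)) (ℚP.*-zeroʳ (c′ i)))) (Σ-zero (suc k)))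

  extend : Dependence reduced → Dependence f
  extend (c′ , (i , c′i≢0) , vanishes) = c c′
    , (punchIn p i , λ eq → c′i≢0 (trans (sym (insertAt-punchIn c′ p (head c′) i)) eq))
    , λ { zero → comb-zero c′ ; (suc l) → trans (comb-c c′ (suc l)) (vanishes l) }

dependent : ∀ k (f : Fin (suc k) → Fin k → ℚ) → Dependence f
dependent zero    f = (λ _ → 1ℚ) , (zero , ℚP.1≢0) , λ ()
dependent (suc k) f = by-pivot (any? (λ i → ¬? (f i zero ℚP.≟ 0ℚ)))
  where
  by-pivot : Dec (∃ λ i → f i zero ≢ 0ℚ) → Dependence f
  by-pivot (yes (p , pivot≢0)) = Pivot.extend f p pivot≢0 (dependent k (Pivot.reduced f p pivot≢0))
  -- With all first entries zero that coordinate imposes nothing; discarding one vector, with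
  -- coefficient 0, restores the count of k + 1 vectors in dimension k.
  by-pivot (no none) = c , (suc (proj₁ (proj₁ (proj₂ tail))) , proj₂ (proj₁ (proj₂ tail))) , vanishes
    where
    tail : Dependence (λ i l → f (suc i) (suc l))
    tail = dependent k (λ i l → f (suc i) (suc l))
    c : Fin (suc (suc k)) → ℚ
    c zero    = 0ℚ
    c (suc i) = proj₁ tail i
    all-zero : ∀ i → f i zero ≡ 0ℚ
    all-zero i = decidable-stable (f i zero ℚP.≟ 0ℚ) (λ ≢0 → none (i , ≢0))
    vanishes : ∀ l → comb c f l ≡ 0ℚ
    vanishes zero = trans (Σ-cong (suc (suc k)) (λ i → trans (cong (c i *_) (all-zero i)) (ℚP.*-zeroʳ (c i))))
      (Σ-zero (suc (suc k)))
    vanishes (suc l) = trans (cong₂ _+_ (ℚP.*-zeroˡ (f zero (suc l))) (proj₂ (proj₂ tail) l)) (ℚP.+-identityˡ 0ℚ)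

lookup-0ᵥ : ∀ {n} (i : Fin n) → Vec.lookup 0ᵥ i ≡ 0ℚ
lookup-0ᵥ i = VecP.lookup-replicate i 0ℚ

lookup-lincomb : ∀ {n} m (c : Fin m → ℚ) (p : Fin m → Pt n) i →
  Vec.lookup (lincomb m c p) i ≡ comb c (Vec.lookup ∘ p) i
lookup-lincomb m c p i = VecP.lookup∘tabulate _ i

module Main {n : ℕ} (2≤n : 2 ≤ n) (G : SimpleGraph n) (conn : Connected G)
            (𝒯 : List (List (Arc n))) (diss : IsDissectingTreeSet G 𝒯) (v : Fin n) where

  open Dissection G conn 𝒯 diss
  open Balanced {g = g} (graphArcs-balanced G) using (pad)
  open Cells 2≤n G conn 𝒯 diss v

  -- The cell of the origin provides one tree of the dissection, against which the dimension is
  -- measured.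
  a₀ : Fin (length 𝒯)
  a₀ = proj₁ (some-cell (λ _ → 0ℚ) (λ _ → isInt-0) (Σ-zero n))

  d : ℕ
  d = dim a₀

  -- The origin lies in the polytope because the arcs of the graph sum to zero; with the arcs of one
  -- tree it gives d + 1 affinely independent points.
  vertex : Fin (suc d) → Fin n → ℚ
  vertex zero    = λ _ → 0ℚ
  vertex (suc j) = basis a₀ j

  vertex-rep : ∀ j → ConicRep g (vertex j) 1ℚ
  vertex-rep zero    = pad (rep-index 0<1 (rep-tree {a₀} (rep-self (someArc a₀)))) 0≤1 rep-zero
  vertex-rep (suc j) = rep-tree (rep-self j)

  vertices-independent : AffIndep d (Vec.tabulate ∘ vertex)
  vertices-independent c eq j = begin
    c j                                ≡⟨ TreeBasis.coord-comb (isTree a₀) j c ⟨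
    coord a₀ j (comb c (basis a₀))     ≡⟨ TreeBasis.coord-cong (isTree a₀) j comb≡0 ⟩
    coord a₀ j (λ _ → 0ℚ)              ≡⟨ trans (Σ-cong n (λ u → ℚP.*-zeroˡ (χ a₀ j u))) (Σ-zero n) ⟩
    0ℚ                                 ∎
    where
    open ≡-Reasoning
    difference : ∀ k i → basis a₀ k i ≡ Vec.lookup (Vec.tabulate (vertex (suc k)) -ᵥ Vec.tabulate (vertex zero)) i
    difference k i = sym (begin
      Vec.lookup (Vec.tabulate (vertex (suc k)) -ᵥ Vec.tabulate (vertex zero)) i
        ≡⟨ VecP.lookup-zipWith _-_ i (Vec.tabulate (vertex (suc k))) (Vec.tabulate (vertex zero)) ⟩
      Vec.lookup (Vec.tabulate (vertex (suc k))) i - Vec.lookup (Vec.tabulate (vertex zero)) i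
        ≡⟨ cong₂ _-_ (VecP.lookup∘tabulate (vertex (suc k)) i) (VecP.lookup∘tabulate (vertex zero) i) ⟩
      basis a₀ k i - 0ℚ
        ≡⟨ solve 1 (λ x → x :- con 0ℚ := x) refl (basis a₀ k i) ⟩
      basis a₀ k i ∎)
    comb≡0 : ∀ i → comb c (basis a₀) i ≡ 0ℚ
    comb≡0 i = trans (Σ-cong d (λ k → cong (c k *_) (difference k i)))
      (trans (sym (lookup-lincomb d c (λ k → Vec.tabulate (vertex (suc k)) -ᵥ Vec.tabulate (vertex zero)) i)) (trans (cong (λ x → Vec.lookup x i) eq) (lookup-0ᵥ i)))

  -- The d + 1 differences have coordinate vectors of length d, hence a dependence. The combination
  -- it defines has entry sum zero and vanishing tree coordinates, so it is zero.
  ¬independent : (p : Fin (suc (suc d)) → Pt n) → (∀ i → InSEP G (p i)) → ¬ AffIndep (suc d) p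
  ¬independent p inP indep = proj₂ (proj₁ (proj₂ dep))
    (indep c lincomb≡0 (proj₁ (proj₁ (proj₂ dep))))
    where
    w : Fin (suc d) → Fin n → ℚ
    w i = Vec.lookup (p (suc i) -ᵥ p zero)
    dep : Dependence (λ i j → coord a₀ j (w i))
    dep = dependent d (λ i j → coord a₀ j (w i))
    c : Fin (suc d) → ℚ
    c = proj₁ dep
    w-sum : ∀ i → Σℚ n (w i) ≡ 0ℚ
    w-sum i = trans (Σ-cong n (λ u → VecP.lookup-zipWith _-_ u (p (suc i)) (p zero)))
      (trans (Σ-minus n (Vec.lookup (p (suc i))) (Vec.lookup (p zero)))
        (trans (cong₂ _-_ (p-sum (suc i)) (p-sum zero)) (ℚP.+-inverseʳ 0ℚ)))
      where
      p-sum : ∀ i → Σℚ n (Vec.lookup (p i)) ≡ 0ℚ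
      p-sum i = rep-sum {es = graphArcs G} (inConv⇒rep (graphArcs G) (inP i))
    comb-w-sum : Σℚ n (comb c w) ≡ 0ℚ
    comb-w-sum = trans (Σ-swap n (suc d) (λ u i → c i * w i u))
      (trans (Σ-cong (suc d) (λ i → trans (Σ-*ˡ n (c i) (w i)) (trans (cong (c i *_) (w-sum i)) (ℚP.*-zeroʳ (c i)))))
        (Σ-zero (suc d)))
    coord-comb-w : ∀ j → coord a₀ j (comb c w) ≡ 0ℚ
    coord-comb-w j = begin
      Σℚ n (λ u → Σℚ (suc d) (λ i → c i * w i u) * χ a₀ j u)
        ≡⟨ Σ-cong n (λ u → sym (Σ-*ʳ (suc d) (χ a₀ j u) (λ i → c i * w i u))) ⟩
      Σℚ n (λ u → Σℚ (suc d) (λ i → c i * w i u * χ a₀ j u))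
        ≡⟨ Σ-swap n (suc d) (λ u i → c i * w i u * χ a₀ j u) ⟩
      Σℚ (suc d) (λ i → Σℚ n (λ u → c i * w i u * χ a₀ j u))
        ≡⟨ Σ-cong (suc d) (λ i → TreeBasis.coord-* (isTree a₀) j (c i) (w i)) ⟩
      Σℚ (suc d) (λ i → c i * coord a₀ j (w i))
        ≡⟨ proj₂ (proj₂ dep) j ⟩
      0ℚ ∎
      where open ≡-Reasoning
    comb≡0 : ∀ u → comb c w u ≡ 0ℚ
    comb≡0 u = trans (coord-spans a₀ (comb c w) comb-w-sum u)
      (trans (Σ-cong d (λ j → trans (cong (_* basis a₀ j u) (coord-comb-w j)) (ℚP.*-zeroˡ (basis a₀ j u)))) (Σ-zero d))
    lincomb≡0 : lincomb (suc d) c (λ i → p (suc i) -ᵥ p zero) ≡ 0ᵥ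
    lincomb≡0 = trans (VecP.tabulate-cong comb≡0) (trans
      (VecP.tabulate-cong (λ u → sym (lookup-0ᵥ u))) (VecP.tabulate∘lookup 0ᵥ))

  isDim : IsDim (InSEP G) d
  isDim = ((Vec.tabulate ∘ vertex) , (λ j → rep⇒inConv (graphArcs G) (vertex-rep j)) , vertices-independent)
    , ¬independent

  -- Edges pointing away from the vertex and the Ehrhart count

  hasCount-away : ∀ a → HasCount (PointsAway (lookup 𝒯 a) v) (awayEdges a)
  hasCount-away a = hasCount-cong
    (λ {j} → FundamentalCut.side⇒pointsAway (isTree a) j v ∘ not-true)
    (λ {j} path → cong not (FundamentalCut.pointsAway⇒side (isTree a) j v path))
    (hasCount-Fin (dim a) (away a))
    where
    not-true : ∀ {b} → not b ≡ true → b ≡ false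
    not-true {false} _ = refl

  awayEdges≤d : ∀ a → awayEdges a ≤ d
  awayEdges≤d a = subst (awayEdges a ≤_) (trans (dim≡ a) (sym (dim≡ a₀))) (count≤ (dim a) (away a))

  module _ (h : ℕ → ℕ) (counts : ∀ i → AwayCount 𝒯 v i (h i)) where

    -- `h` is known only through the enumerations it satisfies. Uniqueness of cardinalities is used
    -- twice: each tree has a single number of edges pointing away, and `h k` must equal the
    -- decidable count.
    h-count : ∀ k → h k ≡ count (length 𝒯) (λ a → does (awayEdges a ℕ.≟ k))
    h-count k = hasCount-unique (counts k) (hasCount-cong
      (λ {a} eq → subst (HasCount (PointsAway (lookup 𝒯 a) v)) (does⇒ (awayEdges a ℕ.≟ k) eq) (hasCount-away a))
      (λ {a} c → dec-true (awayEdges a ℕ.≟ k) (hasCount-unique (hasCount-away a) c))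
      (hasCount-Fin (length 𝒯) (λ a → does (awayEdges a ℕ.≟ k))))

    h-vanishes : ∀ k → d ℕ.< k → h k ≡ 0
    h-vanishes k d<k = hasCount-unique (counts k)
      (hasCount-∅ λ a c → ℕP.<⇒≱ d<k (subst (_≤ d) (hasCount-unique (hasCount-away a) c) (awayEdges≤d a)))

    ehrhart : ∀ t → HasCount (InDilateLattice (InSEP G) t) (ehrhartSum h d t)
    ehrhart t = subst (HasCount (InDilateLattice (InSEP G) t)) (begin
      Σℕ (length 𝒯) (λ a → (t ℕ.+ (dim a ℕ.∸ awayEdges a)) C dim a)
        ≡⟨ Σℕ-cong (length 𝒯) (λ a → cong (λ m → (t ℕ.+ (m ℕ.∸ awayEdges a)) C m) (trans (dim≡ a) (sym (dim≡ a₀)))) ⟩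
      Σℕ (length 𝒯) (λ a → (t ℕ.+ (d ℕ.∸ awayEdges a)) C d)
        ≡⟨ ehrhartSum-by-value (length 𝒯) awayEdges h d t awayEdges≤d h-count ⟨
      ehrhartSum h d t ∎) (hasCount-dilate t)
      where open ≡-Reasoning

theorem1p1 : (n : ℕ) → 2 ≤ n → (G : SimpleGraph n) → Connected G →
    (𝒯 : List (List (Arc n))) → IsDissectingTreeSet G 𝒯 → (v : Fin n) →
    (h : ℕ → ℕ) → (∀ i → AwayCount 𝒯 v i (h i)) →
    IsHStar (InSEP G) h
theorem1p1 n 2≤n G conn 𝒯 diss v h counts =
  d , isDim , h-vanishes h counts , ehrhart h counts
  where open Main 2≤n G conn 𝒯 diss v
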